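{- Let $m$ and $n$ be positive integers and let $j$, $k$ be non-negative integers. Then $$\frac{(1-q^{n-k})(1-q^{k+1})}{(1-q)(1-q^n)}{n+k\brack 2k}{m+1\brack k+1}{m+k\brack k+1}$$ and $$\frac{1-q}{1-q^{k+1}}{n-1\brack k}{n+k\brack k}{2k\brack j+k}{m+k\brack 2k}{m\brack j}{m+j\brack j}$$ are polynomials in $q$ with non-negative integer coefficients.
   Context: The $q$-binomial coefficients are defined by ${n\brack k}=\prod_{i=1}^{k}\frac{1-q^{n-k+i}}{1-q^i}$ if $0\le k\le n$, and ${n\brack k}=0$ otherwise. -}

module Defs where

open import Data.Nat using (ℕ; zero; suc; _≤?_) renaming (_+_ to _+ℕ_)
open import Data.Integer using (ℤ; +_; -[1+_]; _+_; _*_; -_; _-_)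
open import Data.List using (List; []; _∷_; map; replicate; _++_)
open import Data.Product using (_×_; _,_; proj₁; proj₂)
open import Relation.Nullary using (yes; no)
open import Relation.Binary.PropositionalEquality using (_≡_)

-- Polynomials in q with integer coefficients, as coefficient lists
-- (constant term first). Trailing zeros allowed; equality is coefficientwise.
Poly : Set
Poly = List ℤ

coeff : Poly → ℕ → ℤ
coeff []      _       = + 0
coeff (a ∷ p) zero    = a
coeff (a ∷ p) (suc i) = coeff p i

_≈P_ : Poly → Poly → Set
p ≈P r = ∀ i → coeff p i ≡ coeff r i

infixl 6 _+P_
infixl 7 _*P_

_+P_ : Poly → Poly → Poly
[]      +P r       = r
(a ∷ p) +P []      = a ∷ p
(a ∷ p) +P (b ∷ r) = (a + b) ∷ (p +P r)

negP : Poly → Poly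
negP = map (λ x → - x)

_*P_ : Poly → Poly → Poly
[]      *P r = []
(a ∷ p) *P r = map (a *_) r +P (+ 0 ∷ (p *P r))

zeroP oneP : Poly
zeroP = []
oneP  = + 1 ∷ []

qPow : ℕ → Poly
qPow a = replicate a (+ 0) ++ (+ 1 ∷ [])

oneMinusQPow : ℕ → Poly
oneMinusQPow a = oneP +P negP (qPow a)

-- Rational functions in q as (numerator , denominator).
Frac : Set
Frac = Poly × Poly

infixl 7 _*F_
_*F_ : Frac → Frac → Frac
(a , b) *F (c , d) = (a *P c , b *P d)

-- (1 - q^e) for an integer exponent e; for e = -a < 0,
-- 1 - q^{-a} = -(1 - q^a) / q^a.
oneMinusQZ : ℤ → Frac
oneMinusQZ (+ a)      = (oneMinusQPow a , oneP)
oneMinusQZ -[1+ a ]   = (negP (oneMinusQPow (suc a)) , qPow (suc a))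

prodOMQ : ℕ → ℕ → Poly
prodOMQ a zero    = oneP
prodOMQ a (suc k) = prodOMQ a k *P oneMinusQPow (a +ℕ suc k)

qbinom : ℕ → ℕ → Frac
qbinom n k with k ≤? n
... | yes _ = (prodOMQ (n Data.Nat.∸ k) k , prodOMQ 0 k)
... | no  _ = (zeroP , oneP)

-- A rational function N/D (D ≠ 0) is a polynomial in q with non-negative
-- integer coefficients: there is P ∈ ℕ[q] with P · D = N.
IsNatPoly : Frac → Set
IsNatPoly (N , D) = Data.Product.Σ (List ℕ) (λ P → (map +_ P *P D) ≈P N)

expr1 : ℕ → ℕ → ℕ → Frac
expr1 m n k =
  oneMinusQZ (+ n - + k) *F (oneMinusQPow (suc k) , oneP)
  *F (oneP , oneMinusQPow 1 *P oneMinusQPow n)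
  *F qbinom (n +ℕ k) (2 Data.Nat.* k)
  *F qbinom (suc m) (suc k)
  *F qbinom (m +ℕ k) (suc k)

expr2 : ℕ → ℕ → ℕ → ℕ → Frac
expr2 m n j k =
  (oneMinusQPow 1 , oneMinusQPow (suc k))
  *F qbinom (n Data.Nat.∸ 1) k
  *F qbinom (n +ℕ k) k
  *F qbinom (2 Data.Nat.* k) (j +ℕ k)
  *F qbinom (m +ℕ k) (2 Data.Nat.* k)
  *F qbinom m j
  *F qbinom (m +ℕ j) j

{-# OPTIONS --safe #-}
-- Write u n = 1 - q^n, [n] = u n / u 1 and B for the q-binomial coefficient. Everything
-- rests on the identity
--   u (s+e) u (s+e+k) = u e u (2s+k+e) + q^e u s u (s+k).
-- Used once, it writes the first expression (for k ≤ n) as the manifestly positive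
--   B(n-1,k) B(n+k,k) ( q^(m-k) [k] B(m+k,2k) + [2k+1] (1+q^(k+1)) B(m+k+1,2k+2) ).
-- For the second expression the factors B(n-1,k) B(n+k,k) are superfluous: with
-- C_t = B(2t,t) / [t+1] the q-Catalan numbers, a q-Saalschütz expansion gives, for j ≤ k,
--   B(2k,j+k) B(m+k,2k) B(m,j) B(m+j,j) / [k+1]
--     = B(k,j) Σ_{t ≥ k} q^((m-t)(j+k-t)) B(k,t-j) B(m+t,2t) C_t B(t+1,k+1),
-- by induction on j: multiplying the sum by u (m-j) u (m+j+1) and splitting this
-- factor by the identity above in each term makes the sum for j+1 appear by telescoping.
-- Finally C_t is a polynomial with non-negative coefficients, the maj generating
-- function of Dyck words.
module Submission where

open import Defs
open import Algebra.Bundles using (CommutativeRing)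
import Algebra.Properties.Semiring.Exp as Exp
open import Data.Integer as ℤ using (ℤ; +_; ∣_∣)
import Data.Integer.Properties as ℤ
open import Data.List using (List; []; _∷_; map)
open import Data.Nat as ℕ using (ℕ; zero; suc; _∸_; _≤_; _<_; z≤n; s≤s; s≤s⁻¹; _≤?_)
import Data.Nat.Properties as ℕ
open import Data.Nat.Tactic.RingSolver using (solve-∀)
open import Data.Product using (_×_; _,_; proj₁; proj₂)
open import Data.Sum using ([_,_]′)
open import Level using (_⊔_; 0ℓ)
open import Relation.Binary using (Setoid; IsEquivalence)
open import Relation.Binary.PropositionalEquality as ≡ using (_≡_)
import Relation.Binary.Reasoning.Setoid as SetoidReasoning
open import Relation.Nullary using (yes; no)

-- Commutative rings in which every 1 - q^(n+1) can be cancelled.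

-- Cancellation stands in for division: identities between quotients are proved with their
-- denominators cleared, in any ring with this property.
IsQRegular : ∀ {c ℓ} (R : CommutativeRing c ℓ) → CommutativeRing.Carrier R → Set (c ⊔ ℓ)
IsQRegular R q = ∀ n {x y} → (1# - q ^ suc n) * x ≈ (1# - q ^ suc n) * y → x ≈ y
  where
  open CommutativeRing R
  open Exp semiring

module QBinomials {c ℓ} (R : CommutativeRing c ℓ) (q : CommutativeRing.Carrier R)
  (cancel : IsQRegular R q) where

  open CommutativeRing R hiding (zero)
  open Exp semiring
  open import Algebra.Properties.Group +-group using (∙-cancelʳ)
  open import Algebra.Solver.Ring.NaturalCoefficients.Default commutativeSemiring
  open import Relation.Binary.Reasoning.Setoid setoid

  -- The subsemiring generated by `q`. A derivation certifies non-negative coefficients through the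
  -- way an element is built.
  data ℕ[q] : Carrier → Set (c ⊔ ℓ) where
    0∈   : ℕ[q] 0#
    1∈   : ℕ[q] 1#
    q∈   : ℕ[q] q
    _+∈_ : ∀ {x y} → ℕ[q] x → ℕ[q] y → ℕ[q] (x + y)
    _*∈_ : ∀ {x y} → ℕ[q] x → ℕ[q] y → ℕ[q] (x * y)

  ^∈ : ∀ n → ℕ[q] (q ^ n)
  ^∈ zero    = 1∈
  ^∈ (suc n) = q∈ *∈ ^∈ n

  -- The factors `u n` and their quadratic identity.

  u : ℕ → Carrier
  u n = 1# - q ^ n

  u-cong : ∀ {m n} → m ≡ n → u m ≈ u n
  u-cong eq = reflexive (≡.cong u eq)

  u+q^≈1 : ∀ n → u n + q ^ n ≈ 1#
  u+q^≈1 n = begin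
    1# - q ^ n + q ^ n      ≈⟨ +-assoc _ _ _ ⟩
    1# + (- q ^ n + q ^ n)  ≈⟨ +-congˡ (-‿inverseˡ _) ⟩
    1# + 0#                 ≈⟨ +-identityʳ _ ⟩
    1#                      ∎

  u0≈0 : u 0 ≈ 0#
  u0≈0 = -‿inverseʳ 1#

  u*x+q^*x≈x : ∀ n x → u n * x + q ^ n * x ≈ x
  u*x+q^*x≈x n x = begin
    u n * x + q ^ n * x  ≈⟨ distribʳ x _ _ ⟨
    (u n + q ^ n) * x    ≈⟨ *-congʳ (u+q^≈1 n) ⟩
    1# * x               ≈⟨ *-identityˡ x ⟩
    x                    ∎

  u-+ : ∀ m n → u (m ℕ.+ n) ≈ u m + q ^ m * u n
  -- Adding `q ^ (m + n)` to both sides removes the subtraction, so that the semiring solver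
  -- applies.
  u-+ m n = ∙-cancelʳ (q ^ (m ℕ.+ n)) _ _ (begin
    u (m ℕ.+ n) + q ^ (m ℕ.+ n)            ≈⟨ u+q^≈1 (m ℕ.+ n) ⟩
    1#                                     ≈⟨ u+q^≈1 m ⟨
    u m + q ^ m                            ≈⟨ +-congˡ (*-identityʳ _) ⟨
    u m + q ^ m * 1#                       ≈⟨ +-congˡ (*-congˡ (u+q^≈1 n)) ⟨
    u m + q ^ m * (u n + q ^ n)            ≈⟨ solve 4 (λ a b c d → a :+ b :* (c :+ d) := a :+ b :* c :+ b :* d) refl _ _ _ _ ⟩
    u m + q ^ m * u n + q ^ m * q ^ n      ≈⟨ +-congˡ (^-homo-* q m n) ⟨
    u m + q ^ m * u n + q ^ (m ℕ.+ n)      ∎)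

  -- Splitting the sums by `u-+` leaves a semiring identity in `u e`, `q ^ e`, `u s`, `u (s + k)`
  -- and `q ^ (s + k)`.
  u-quadratic : ∀ s e k → u (s ℕ.+ e) * u (s ℕ.+ e ℕ.+ k) ≈
                u e * u (s ℕ.+ k ℕ.+ s ℕ.+ e) + q ^ e * (u s * u (s ℕ.+ k))
  u-quadratic s e k = begin
    u (s ℕ.+ e) * u (s ℕ.+ e ℕ.+ k)
      ≈⟨ *-cong (trans (u-cong (ℕ.+-comm s e)) (u-+ e s)) (u-cong (assoc-swap s e k)) ⟩
    (a + A * x) * u (s ℕ.+ k ℕ.+ e)
      ≈⟨ distribʳ _ _ _ ⟩
    a * u (s ℕ.+ k ℕ.+ e) + A * x * u (s ℕ.+ k ℕ.+ e)
      ≈⟨ +-cong (*-congˡ (trans (u-cong (ℕ.+-comm (s ℕ.+ k) e)) (u-+ e (s ℕ.+ k)))) (*-congˡ (u-+ (s ℕ.+ k) e)) ⟩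
    a * (a + A * y) + A * x * (y + Y * a)
      ≈⟨ solve 5 (λ a A x y Y → a :* (a :+ A :* y) :+ A :* x :* (y :+ Y :* a)
                  := a :* (a :+ A :* (y :+ Y :* x)) :+ A :* (x :* y)) refl a A x y Y ⟩
    a * (a + A * (y + Y * x)) + A * (x * y)
      ≈⟨ +-congʳ (*-congˡ (+-congˡ (*-congˡ (u-+ (s ℕ.+ k) s)))) ⟨
    a * (a + A * u (s ℕ.+ k ℕ.+ s)) + A * (x * y)
      ≈⟨ +-congʳ (*-congˡ (trans (u-cong (ℕ.+-comm _ e)) (u-+ e (s ℕ.+ k ℕ.+ s)))) ⟨
    a * u (s ℕ.+ k ℕ.+ s ℕ.+ e) + A * (x * y) ∎
    where
    a A x y Y : Carrier
    a = u e
    A = q ^ e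
    x = u s
    y = u (s ℕ.+ k)
    Y = q ^ (s ℕ.+ k)
    assoc-swap : ∀ s e k → s ℕ.+ e ℕ.+ k ≡ s ℕ.+ k ℕ.+ e
    assoc-swap = solve-∀

  -- Gaussian binomial coefficients: absorption rules and product formula.

  -- Pascal's rule as the definition makes membership in `ℕ[q]` immediate; the product formula is
  -- recovered in `B*uProd`.
  B : ℕ → ℕ → Carrier
  B n       zero    = 1#
  B zero    (suc k) = 0#
  B (suc n) (suc k) = B n k + q ^ suc k * B n (suc k)

  B∈ : ∀ n k → ℕ[q] (B n k)
  B∈ n       zero    = 1∈
  B∈ zero    (suc k) = 0∈
  B∈ (suc n) (suc k) = B∈ n k +∈ (^∈ (suc k) *∈ B∈ n (suc k))

  B-cong : ∀ {n n′ k k′} → n ≡ n′ → k ≡ k′ → B n k ≈ B n′ k′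
  B-cong n≡n′ k≡k′ = reflexive (≡.cong₂ B n≡n′ k≡k′)

  B-congˡ : ∀ k {n n′} → n ≡ n′ → B n k ≈ B n′ k
  B-congˡ k n≡n′ = B-cong n≡n′ (≡.refl {x = k})

  B-vanish : ∀ {n k} → n < k → B n k ≈ 0#
  B-vanish {zero}  {suc k} _   = refl
  B-vanish {suc n} {suc k} n<k = begin
    B n k + q ^ suc k * B n (suc k)  ≈⟨ +-cong (B-vanish (s≤s⁻¹ n<k)) (*-congˡ (B-vanish (ℕ.m<n⇒m<1+n (s≤s⁻¹ n<k)))) ⟩
    0# + q ^ suc k * 0#              ≈⟨ trans (+-identityˡ _) (zeroʳ _) ⟩
    0#                               ∎

  -- Disposes of the cases `m < t`, in which the truncated `m ∸ t` differs from the integer m - t.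
  B-vanish-2* : ∀ {m t} → m < t → B (m ℕ.+ t) (2 ℕ.* t) ≈ 0#
  B-vanish-2* {m} {t} m<t = B-vanish
    (≡.subst (m ℕ.+ t <_) (≡.cong (t ℕ.+_) (≡.sym (ℕ.+-identityʳ t))) (ℕ.+-monoˡ-< t m<t))

  mutual
    -- The absorption rules are proved together by induction on `n`. Pascal's rule and `B-sucʳ` at
    -- `n` give `B-suc` at `n`; the two combine to `B-sucˡ′` at `n`; and `B-suc` with `B-sucˡ′` give
    -- `B-sucʳ` at `suc n`.
    B-sucʳ : ∀ n k → u (suc k) * B n (suc k) ≈ u (n ∸ k) * B n k
    B-sucʳ zero    k = begin
      u (suc k) * 0#       ≈⟨ zeroʳ _ ⟩
      0#                   ≈⟨ zeroˡ _ ⟨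
      0# * B 0 k           ≈⟨ *-congʳ (trans (u-cong (ℕ.0∸n≡0 k)) u0≈0) ⟨
      u (0 ∸ k) * B 0 k    ∎
    B-sucʳ (suc n) zero    = B-suc n zero
    B-sucʳ (suc n) (suc k) = begin
      u (suc (suc k)) * B (suc n) (suc (suc k))  ≈⟨ B-suc n (suc k) ⟩
      u (suc n) * B n (suc k)                    ≈⟨ B-sucˡ′ n k ⟩
      u (n ∸ k) * B (suc n) (suc k)              ∎

    B-suc : ∀ n k → u (suc k) * B (suc n) (suc k) ≈ u (suc n) * B n k
    B-suc n k with k ≤? n
    ... | yes k≤n = begin
      u (suc k) * (B n k + q ^ suc k * B n (suc k))
        ≈⟨ solve 4 (λ a b c d → a :* (b :+ c :* d) := a :* b :+ c :* (a :* d)) refl _ _ _ _ ⟩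
      u (suc k) * B n k + q ^ suc k * (u (suc k) * B n (suc k))
        ≈⟨ +-congˡ (*-congˡ (B-sucʳ n k)) ⟩
      u (suc k) * B n k + q ^ suc k * (u (n ∸ k) * B n k)
        ≈⟨ solve 4 (λ a b c d → a :* b :+ c :* (d :* b) := (a :+ c :* d) :* b) refl _ _ _ _ ⟩
      (u (suc k) + q ^ suc k * u (n ∸ k)) * B n k
        ≈⟨ *-congʳ (u-+ (suc k) (n ∸ k)) ⟨
      u (suc k ℕ.+ (n ∸ k)) * B n k
        ≈⟨ *-congʳ (u-cong (≡.cong suc (ℕ.m+[n∸m]≡n k≤n))) ⟩
      u (suc n) * B n k ∎
    ... | no k≰n = begin
      u (suc k) * B (suc n) (suc k)  ≈⟨ *-congˡ (B-vanish (s≤s (ℕ.≰⇒> k≰n))) ⟩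
      u (suc k) * 0#                 ≈⟨ trans (zeroʳ _) (sym (zeroʳ _)) ⟩
      u (suc n) * 0#                 ≈⟨ *-congˡ (B-vanish (ℕ.≰⇒> k≰n)) ⟨
      u (suc n) * B n k              ∎

    private
      B-sucˡ′ : ∀ n k → u (suc n) * B n (suc k) ≈ u (n ∸ k) * B (suc n) (suc k)
      B-sucˡ′ n k = cancel k (begin
        u (suc k) * (u (suc n) * B n (suc k))          ≈⟨ swap _ _ _ ⟩
        u (suc n) * (u (suc k) * B n (suc k))          ≈⟨ *-congˡ (B-sucʳ n k) ⟩
        u (suc n) * (u (n ∸ k) * B n k)                ≈⟨ swap _ _ _ ⟩
        u (n ∸ k) * (u (suc n) * B n k)                ≈⟨ *-congˡ (B-suc n k) ⟨
        u (n ∸ k) * (u (suc k) * B (suc n) (suc k))    ≈⟨ swap _ _ _ ⟩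
        u (suc k) * (u (n ∸ k) * B (suc n) (suc k))    ∎)
        where
        swap : ∀ x y z → x * (y * z) ≈ y * (x * z)
        swap = solve 3 (λ x y z → x :* (y :* z) := y :* (x :* z)) refl

  B-sucˡ : ∀ n k → u (suc n) * B n k ≈ u (suc n ∸ k) * B (suc n) k
  B-sucˡ n zero    = refl
  B-sucˡ n (suc k) = B-sucˡ′ n k

  B-diag : ∀ n → B n n ≈ 1#
  B-diag zero    = refl
  B-diag (suc n) = begin
    B n n + q ^ suc n * B n (suc n)  ≈⟨ +-cong (B-diag n) (*-congˡ (B-vanish (ℕ.n<1+n n))) ⟩
    1# + q ^ suc n * 0#              ≈⟨ +-congˡ (zeroʳ _) ⟩
    1# + 0#                          ≈⟨ +-identityʳ _ ⟩
    1#                               ∎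

  uProd : ℕ → ℕ → Carrier
  uProd a zero    = 1#
  uProd a (suc k) = uProd a k * u (a ℕ.+ suc k)

  uProd-+ : ∀ a k l → uProd a (k ℕ.+ l) ≈ uProd a k * uProd (a ℕ.+ k) l
  uProd-+ a k zero    = trans (reflexive (≡.cong (uProd a) (ℕ.+-identityʳ k))) (sym (*-identityʳ _))
  uProd-+ a k (suc l) = begin
    uProd a (k ℕ.+ suc l)                                    ≈⟨ reflexive (≡.cong (uProd a) (ℕ.+-suc k l)) ⟩
    uProd a (k ℕ.+ l) * u (a ℕ.+ suc (k ℕ.+ l))              ≈⟨ *-cong (uProd-+ a k l) (u-cong (≡.trans (≡.cong (a ℕ.+_) (≡.sym (ℕ.+-suc k l))) (≡.sym (ℕ.+-assoc a k (suc l))))) ⟩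
    uProd a k * uProd (a ℕ.+ k) l * u (a ℕ.+ k ℕ.+ suc l)    ≈⟨ *-assoc _ _ _ ⟩
    uProd a k * uProd (a ℕ.+ k) (suc l)                      ∎

  uProd-cancel : ∀ k {x y} → uProd 0 k * x ≈ uProd 0 k * y → x ≈ y
  uProd-cancel zero    eq = trans (sym (*-identityˡ _)) (trans eq (*-identityˡ _))
  uProd-cancel (suc k) eq = cancel k (uProd-cancel k (trans (sym (*-assoc _ _ _)) (trans eq (*-assoc _ _ _))))

  B*uProd : ∀ a k → B (a ℕ.+ k) k * uProd 0 k ≈ uProd a k
  B*uProd a zero    = *-identityˡ _
  B*uProd a (suc k) = begin
    B (a ℕ.+ suc k) (suc k) * (uProd 0 k * u (suc k))   ≈⟨ *-congʳ (B-congˡ (suc k) (ℕ.+-suc a k)) ⟩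
    B (suc (a ℕ.+ k)) (suc k) * (uProd 0 k * u (suc k)) ≈⟨ solve 3 (λ x y z → x :* (y :* z) := z :* x :* y) refl _ _ _ ⟩
    u (suc k) * B (suc (a ℕ.+ k)) (suc k) * uProd 0 k   ≈⟨ *-congʳ (B-suc (a ℕ.+ k) k) ⟩
    u (suc (a ℕ.+ k)) * B (a ℕ.+ k) k * uProd 0 k       ≈⟨ solve 3 (λ x y z → x :* y :* z := y :* z :* x) refl _ _ _ ⟩
    B (a ℕ.+ k) k * uProd 0 k * u (suc (a ℕ.+ k))       ≈⟨ *-cong (B*uProd a k) (u-cong (≡.sym (ℕ.+-suc a k))) ⟩
    uProd a k * u (a ℕ.+ suc k)                         ∎

  -- For `k ≤ n` both sides are the q-multinomial coefficient [n+k]! / ([k]! [k]! [n-k]!):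
  -- multiplied twice by `uProd 0 k`, each becomes `uProd (n ∸ k) (k + k)`. For `k > n` both sides
  -- vanish.
  B-trinomial : ∀ n k → B (n ℕ.+ k) k * B n k ≈ B (n ℕ.+ k) (2 ℕ.* k) * B (2 ℕ.* k) k
  B-trinomial n k with k ≤? n
  ... | no k≰n = begin
    B (n ℕ.+ k) k * B n k                        ≈⟨ *-congˡ (B-vanish n<k) ⟩
    B (n ℕ.+ k) k * 0#                           ≈⟨ trans (zeroʳ _) (sym (zeroˡ _)) ⟩
    0# * B (2 ℕ.* k) k                           ≈⟨ *-congʳ (B-vanish-2* n<k) ⟨
    B (n ℕ.+ k) (2 ℕ.* k) * B (2 ℕ.* k) k        ∎
    where
    n<k : n < k
    n<k = ℕ.≰⇒> k≰n
  ... | yes k≤n = uProd-cancel k (uProd-cancel k (begin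
    f * (f * (B (n ℕ.+ k) k * B n k))
      ≈⟨ *-congˡ (*-congˡ (*-cong (B-congˡ k (≡.cong (ℕ._+ k) (≡.sym a+k≡n))) (B-congˡ k (≡.sym a+k≡n)))) ⟩
    f * (f * (B (a ℕ.+ k ℕ.+ k) k * B (a ℕ.+ k) k))
      ≈⟨ solve 3 (λ f x y → f :* (f :* (x :* y)) := y :* f :* (x :* f)) refl _ _ _ ⟩
    (B (a ℕ.+ k) k * f) * (B (a ℕ.+ k ℕ.+ k) k * f)
      ≈⟨ *-cong (B*uProd a k) (B*uProd (a ℕ.+ k) k) ⟩
    uProd a k * uProd (a ℕ.+ k) k
      ≈⟨ uProd-+ a k k ⟨
    uProd a (k ℕ.+ k)
      ≈⟨ B*uProd a (k ℕ.+ k) ⟨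
    B (a ℕ.+ (k ℕ.+ k)) (k ℕ.+ k) * uProd 0 (k ℕ.+ k)
      ≈⟨ *-congˡ (trans (uProd-+ 0 k k) (*-congˡ (sym (B*uProd k k)))) ⟩
    B (a ℕ.+ (k ℕ.+ k)) (k ℕ.+ k) * (f * (B (k ℕ.+ k) k * f))
      ≈⟨ solve 3 (λ f x y → x :* (f :* (y :* f)) := f :* (f :* (x :* y))) refl _ _ _ ⟩
    f * (f * (B (a ℕ.+ (k ℕ.+ k)) (k ℕ.+ k) * B (k ℕ.+ k) k))
      ≈⟨ *-congˡ (*-congˡ (*-cong (B-cong (≡.trans (≡.sym (ℕ.+-assoc a k k)) (≡.cong (ℕ._+ k) a+k≡n)) k+k≡2*k) (B-congˡ k k+k≡2*k))) ⟩
    f * (f * (B (n ℕ.+ k) (2 ℕ.* k) * B (2 ℕ.* k) k)) ∎))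
    where
    a : ℕ
    a = n ∸ k
    f : Carrier
    f = uProd 0 k
    a+k≡n : a ℕ.+ k ≡ n
    a+k≡n = ℕ.m∸n+n≡m k≤n
    k+k≡2*k : k ℕ.+ k ≡ 2 ℕ.* k
    k+k≡2*k = ≡.cong (k ℕ.+_) (≡.sym (ℕ.+-identityʳ k))

  -- The q-integers.

  qNum : ℕ → Carrier
  qNum zero    = 0#
  qNum (suc n) = qNum n + q ^ n

  qNum∈ : ∀ n → ℕ[q] (qNum n)
  qNum∈ zero    = 0∈
  qNum∈ (suc n) = qNum∈ n +∈ ^∈ n

  u1*qNum : ∀ n → u 1 * qNum n ≈ u n
  u1*qNum zero    = trans (zeroʳ _) (sym u0≈0)
  u1*qNum (suc n) = begin
    u 1 * (qNum n + q ^ n)      ≈⟨ solve 3 (λ x y z → x :* (y :+ z) := x :* y :+ z :* x) refl _ _ _ ⟩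
    u 1 * qNum n + q ^ n * u 1  ≈⟨ +-congʳ (u1*qNum n) ⟩
    u n + q ^ n * u 1           ≈⟨ u-+ n 1 ⟨
    u (n ℕ.+ 1)                 ≈⟨ u-cong (ℕ.+-comm n 1) ⟩
    u (suc n)                   ∎

  -- Ballot polynomials and q-Catalan numbers.

  -- The maj generating function of the words with b + c letters 1 and b letters 2
  -- all of whose prefixes contain at least as many 1s as 2s; ballot₁ c b counts
  -- those with b + 1 letters 2 and b + 1 + c letters 1 that end in 1.
  mutual
    ballot : ℕ → ℕ → Carrier
    ballot c zero    = 1#
    ballot c (suc b) = ballot₁ c b + ballot (suc c) b

    ballot₁ : ℕ → ℕ → Carrier
    ballot₁ zero    b = 0#
    ballot₁ (suc c) b = ballot₁ c b + q ^ (2 ℕ.+ (2 ℕ.* b ℕ.+ c)) * ballot (suc c) b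

  mutual
    ballot∈ : ∀ c b → ℕ[q] (ballot c b)
    ballot∈ c zero    = 1∈
    ballot∈ c (suc b) = ballot₁∈ c b +∈ ballot∈ (suc c) b

    ballot₁∈ : ∀ c b → ℕ[q] (ballot₁ c b)
    ballot₁∈ zero    b = 0∈
    ballot₁∈ (suc c) b = ballot₁∈ c b +∈ (^∈ (2 ℕ.+ (2 ℕ.* b ℕ.+ c)) *∈ ballot∈ (suc c) b)

  -- The coefficient B(n,k-1), extended by 0 to `k = 0`, so that the closed form of `ballot` also
  -- covers `b = 0`.
  B⁻ : ℕ → ℕ → Carrier
  B⁻ n zero    = 0#
  B⁻ n (suc k) = B n k

  B⁻-congˡ : ∀ k {n n′} → n ≡ n′ → B⁻ n k ≈ B⁻ n′ k
  B⁻-congˡ k n≡n′ = reflexive (≡.cong (λ n → B⁻ n k) n≡n′)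

  B-pascal⁻ : ∀ n k → B (suc n) k ≈ B⁻ n k + q ^ k * B n k
  B-pascal⁻ n zero    = sym (trans (+-identityˡ _) (*-identityˡ _))
  B-pascal⁻ n (suc k) = refl

  -- Splitting `B n k` by `u (suc n) + q ^ suc n = 1` and absorbing the first part completes the
  -- Pascal term `q ^ suc k * B (suc n) (suc k)`. The exponent `suc n` on the right is the weight of
  -- a descent in `ballot₁`.
  B-recurrence : ∀ n k → B (2 ℕ.+ n) (suc k) + B n k ≈
                 B (suc n) (suc k) + (B (suc n) k + q ^ suc n * B n k)
  B-recurrence n k = begin
    x + q ^ suc k * y + z
      ≈⟨ +-congˡ (u*x+q^*x≈x (suc n) z) ⟨
    x + q ^ suc k * y + (u (suc n) * z + q ^ suc n * z)
      ≈⟨ +-congˡ (+-congʳ (B-suc n k)) ⟨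
    x + q ^ suc k * y + (u (suc k) * y + q ^ suc n * z)
      ≈⟨ solve 4 (λ x a b c → x :+ a :+ (b :+ c) := b :+ a :+ (x :+ c)) refl _ _ _ _ ⟩
    u (suc k) * y + q ^ suc k * y + (x + q ^ suc n * z)
      ≈⟨ +-congʳ (u*x+q^*x≈x (suc k) y) ⟩
    y + (x + q ^ suc n * z) ∎
    where
    x y z : Carrier
    x = B (suc n) k
    y = B (suc n) (suc k)
    z = B n k

  B⁻-recurrence : ∀ n k → B (2 ℕ.+ n) k + B⁻ n k ≈
                  B (suc n) k + (B⁻ (suc n) k + q ^ suc n * B⁻ n k)
  B⁻-recurrence n zero    = +-congˡ (sym (trans (+-identityˡ _) (zeroʳ _)))
  B⁻-recurrence n (suc k) = B-recurrence n k

  -- The absorption factors on the two sides coincide here, because 2b + 1 - b = b + 1.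
  B-middle : ∀ b → B (suc (2 ℕ.* b)) (suc b) ≈ B (suc (2 ℕ.* b)) b
  B-middle b = cancel b (trans (B-sucʳ (suc (2 ℕ.* b)) b) (*-congʳ (u-cong 1+2b∸b≡1+b)))
    where
    1+2b∸b≡1+b : suc (2 ℕ.* b) ∸ b ≡ suc b
    1+2b∸b≡1+b = ≡.trans (ℕ.+-∸-assoc 1 (ℕ.m≤m+n b (b ℕ.+ 0)))
      (≡.cong suc (≡.trans (ℕ.m+n∸m≡n b (b ℕ.+ 0)) (ℕ.+-identityʳ b)))

  -- A q-analogue of the reflection principle, B(N,b) - q B(N,b-1) with N = 2b + c, written without
  -- subtraction. The induction is on `b`, and on `c` for fixed `b`.
  ballot-closed : ∀ c b → ballot c b + q * B⁻ (2 ℕ.* b ℕ.+ c) b ≈ B (2 ℕ.* b ℕ.+ c) b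
  ballot-closed c       zero    = trans (+-congˡ (zeroʳ q)) (+-identityʳ 1#)
  -- For `c = 0` there is no descent term. Pascal's rule expands both binomials of the claim, and
  -- `B-middle` matches the results.
  ballot-closed zero    (suc b) = begin
    0# + x + q * B⁻ (2 ℕ.* suc b ℕ.+ 0) (suc b)
      ≈⟨ +-cong (+-identityˡ x) (*-congˡ (trans (B-congˡ b 2+2b) (B-pascal⁻ (suc (2 ℕ.* b)) b))) ⟩
    x + q * (B⁻ N b + q ^ b * B N b)
      ≈⟨ solve 5 (λ x q y z w → x :+ q :* (y :+ z :* w) := x :+ q :* y :+ q :* z :* w) refl _ _ _ _ _ ⟩
    x + q * B⁻ N b + q ^ suc b * B N b
      ≈⟨ +-cong (trans (+-congˡ (*-congˡ (B⁻-congˡ b 1+2b))) (trans (ballot-closed 1 b) (B-congˡ b (≡.sym 1+2b))))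
                (*-congˡ (sym (B-middle b))) ⟩
    B N b + q ^ suc b * B N (suc b)
      ≈⟨ B-congˡ (suc b) 2+2b ⟨
    B (2 ℕ.* suc b ℕ.+ 0) (suc b) ∎
    where
    N : ℕ
    N = suc (2 ℕ.* b)
    x : Carrier
    x = ballot 1 b
    1+2b : suc (2 ℕ.* b) ≡ 2 ℕ.* b ℕ.+ 1
    1+2b = ℕ.+-comm 1 (2 ℕ.* b)
    2+2b : 2 ℕ.* suc b ℕ.+ 0 ≡ suc (suc (2 ℕ.* b))
    2+2b = ≡.trans (ℕ.+-identityʳ _) (ℕ.*-suc 2 b)
  ballot-closed (suc c) (suc b) = step
    (trans (+-congˡ (*-congˡ (B⁻-congˡ b (≡.sym idx₁)))) (trans (ballot-closed (suc c) b) (B-congˡ b idx₁)))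
    (trans (+-congˡ (*-congˡ (B⁻-congˡ b (≡.sym idx₂)))) (trans (ballot-closed (suc (suc c)) b) (B-congˡ b idx₂)))
    (trans (+-congˡ (*-congˡ (B-congˡ b (≡.sym idx₂′)))) (trans (ballot-closed c (suc b)) (B-congˡ (suc b) idx₂′)))
    where
    n : ℕ
    n = suc (2 ℕ.* b ℕ.+ c)
    l Q x y : Carrier
    l = ballot₁ c b
    Q = q ^ suc n
    x = ballot (suc c) b
    y = ballot (suc (suc c)) b
    idx₁ : 2 ℕ.* b ℕ.+ suc c ≡ n
    idx₁ = ℕ.+-suc (2 ℕ.* b) c
    idx₂ : 2 ℕ.* b ℕ.+ suc (suc c) ≡ suc n
    idx₂ = ≡.trans (ℕ.+-suc (2 ℕ.* b) (suc c)) (≡.cong suc idx₁)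
    idx₂′ : 2 ℕ.* suc b ℕ.+ c ≡ suc n
    idx₂′ = ≡.cong (ℕ._+ c) (ℕ.*-suc 2 b)
    idx₃ : 2 ℕ.* suc b ℕ.+ suc c ≡ 2 ℕ.+ n
    idx₃ = ≡.trans (ℕ.+-suc (2 ℕ.* suc b) c) (≡.cong suc idx₂′)
    step : x + q * B⁻ n b ≈ B n b → y + q * B⁻ (suc n) b ≈ B (suc n) b →
           l + x + q * B (suc n) b ≈ B (suc n) (suc b) →
           l + Q * x + y + q * B (2 ℕ.* suc b ℕ.+ suc c) b ≈ B (2 ℕ.* suc b ℕ.+ suc c) (suc b)
    -- Adding `B n b`, rewritten on the left by `IHx`, supplies the extra summand that
    -- `B⁻-recurrence` and `B-recurrence` carry.
    step IHx IHy IHl = ∙-cancelʳ (B n b) _ _ (begin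
      l + Q * x + y + q * B (2 ℕ.* suc b ℕ.+ suc c) b + B n b
        ≈⟨ +-cong (+-congˡ (*-congˡ (B-congˡ b idx₃))) (sym IHx) ⟩
      l + Q * x + y + q * B (2 ℕ.+ n) b + (x + q * B⁻ n b)
        ≈⟨ solve 7 (λ l Q x y q b₂ b⁻ → l :+ Q :* x :+ y :+ q :* b₂ :+ (x :+ q :* b⁻)
                     := l :+ x :+ (y :+ Q :* x) :+ q :* (b₂ :+ b⁻)) refl l Q x y q _ _ ⟩
      l + x + (y + Q * x) + q * (B (2 ℕ.+ n) b + B⁻ n b)
        ≈⟨ +-congˡ (*-congˡ (B⁻-recurrence n b)) ⟩
      l + x + (y + Q * x) + q * (B (suc n) b + (B⁻ (suc n) b + Q * B⁻ n b))
        ≈⟨ solve 8 (λ l Q x y q b₁ b⁻₁ b⁻ → l :+ x :+ (y :+ Q :* x) :+ q :* (b₁ :+ (b⁻₁ :+ Q :* b⁻))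
                     := l :+ x :+ q :* b₁ :+ (y :+ q :* b⁻₁ :+ Q :* (x :+ q :* b⁻))) refl l Q x y q _ _ _ ⟩
      l + x + q * B (suc n) b + (y + q * B⁻ (suc n) b + Q * (x + q * B⁻ n b))
        ≈⟨ +-cong IHl (+-cong IHy (*-congˡ IHx)) ⟩
      B (suc n) (suc b) + (B (suc n) b + Q * B n b)
        ≈⟨ B-recurrence n b ⟨
      B (2 ℕ.+ n) (suc b) + B n b
        ≈⟨ +-congʳ (B-congˡ (suc b) idx₃) ⟨
      B (2 ℕ.* suc b ℕ.+ suc c) (suc b) + B n b ∎)

  catalan : ℕ → Carrier
  catalan t = ballot 0 t

  -- By `ballot-closed`, C_t = B(2t,t) - q B(2t,t-1). Absorption gives u(t) B(2t,t) = u(t+1)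
  -- B(2t,t-1), and u(t+1) - q u(t) = u(1). The subtracted term is added to both sides instead.
  u*catalan : ∀ t → u (suc t) * catalan t ≈ u 1 * B (2 ℕ.* t) t
  u*catalan zero    = refl
  u*catalan (suc b) = ∙-cancelʳ (q * (u t * B₁)) _ _ (begin
    u (suc t) * C + q * (u t * B₁)
      ≈⟨ +-congˡ (*-congˡ (trans (B-sucʳ (2 ℕ.* t) b) (*-congʳ (u-cong 2t∸b≡1+t)))) ⟩
    u (suc t) * C + q * (u (suc t) * B₀)
      ≈⟨ solve 4 (λ a c q b → a :* c :+ q :* (a :* b) := a :* (c :+ q :* b)) refl _ _ _ _ ⟩
    u (suc t) * (C + q * B₀)
      ≈⟨ *-congˡ (trans (+-congˡ (*-congˡ (B-congˡ b 2t≡)))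
           (trans (ballot-closed 0 t) (B-congˡ t (≡.sym 2t≡)))) ⟩
    u (suc t) * B₁
      ≈⟨ *-congʳ (trans (u-+ 1 t) (+-congˡ (*-congʳ (*-identityʳ q)))) ⟩
    (u 1 + q * u t) * B₁
      ≈⟨ solve 4 (λ a q c b → (a :+ q :* c) :* b := a :* b :+ q :* (c :* b)) refl _ _ _ _ ⟩
    u 1 * B₁ + q * (u t * B₁) ∎)
    where
    t : ℕ
    t = suc b
    C B₀ B₁ : Carrier
    C  = catalan t
    B₀ = B (2 ℕ.* t) b
    B₁ = B (2 ℕ.* t) t
    2t≡ : 2 ℕ.* t ≡ 2 ℕ.* t ℕ.+ 0
    2t≡ = ≡.sym (ℕ.+-identityʳ (2 ℕ.* t))
    2t∸b≡1+t : 2 ℕ.* t ∸ b ≡ suc t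
    2t∸b≡1+t = ≡.trans (≡.cong (_∸ b) (2t≡b+1+t b)) (ℕ.m+n∸m≡n b (suc t))
      where
      2t≡b+1+t : ∀ b → 2 ℕ.* suc b ≡ b ℕ.+ suc (suc b)
      2t≡b+1+t = solve-∀

  -- The ratio of consecutive q-Catalan numbers, arranged so that the factors on the left are those
  -- on the left of `B-suc-suc`.
  catalan-suc : ∀ t → u (suc (2 ℕ.* t)) * u (2 ℕ.+ 2 ℕ.* t) * catalan t ≈
                u (suc t) * u (2 ℕ.+ t) * catalan (suc t)
  catalan-suc t = cancel t (begin
    u (suc t) * (a * b * catalan t)
      ≈⟨ solve 4 (λ x a b c → x :* (a :* b :* c) := a :* b :* (x :* c)) refl _ _ _ _ ⟩
    a * b * (u (suc t) * catalan t)
      ≈⟨ *-congˡ (u*catalan t) ⟩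
    a * b * (u 1 * B (2 ℕ.* t) t)
      ≈⟨ solve 4 (λ a b v x → a :* b :* (v :* x) := v :* b :* (a :* x)) refl _ _ _ _ ⟩
    u 1 * b * (a * B (2 ℕ.* t) t)
      ≈⟨ *-congˡ (trans (B-sucˡ (2 ℕ.* t) t) (*-congʳ (u-cong 1+2t∸t≡1+t))) ⟩
    u 1 * b * (u (suc t) * B (suc (2 ℕ.* t)) t)
      ≈⟨ solve 4 (λ v b x y → v :* b :* (x :* y) := v :* x :* (b :* y)) refl _ _ _ _ ⟩
    u 1 * u (suc t) * (b * B (suc (2 ℕ.* t)) t)
      ≈⟨ *-congˡ (B-suc (suc (2 ℕ.* t)) t) ⟨
    u 1 * u (suc t) * (u (suc t) * B (2 ℕ.+ 2 ℕ.* t) (suc t))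
      ≈⟨ *-congˡ (*-congˡ (B-congˡ (suc t) (ℕ.*-suc 2 t))) ⟨
    u 1 * u (suc t) * (u (suc t) * B (2 ℕ.* suc t) (suc t))
      ≈⟨ solve 3 (λ v x y → v :* x :* (x :* y) := x :* (x :* (v :* y))) refl _ _ _ ⟩
    u (suc t) * (u (suc t) * (u 1 * B (2 ℕ.* suc t) (suc t)))
      ≈⟨ *-congˡ (*-congˡ (u*catalan (suc t))) ⟨
    u (suc t) * (u (suc t) * (u (2 ℕ.+ t) * catalan (suc t)))
      ≈⟨ *-congˡ (*-assoc _ _ _) ⟨
    u (suc t) * (u (suc t) * u (2 ℕ.+ t) * catalan (suc t)) ∎)
    where
    a b : Carrier
    a = u (suc (2 ℕ.* t))
    b = u (2 ℕ.+ 2 ℕ.* t)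
    1+2t∸t≡1+t : suc (2 ℕ.* t) ∸ t ≡ suc t
    1+2t∸t≡1+t = ≡.trans (≡.cong (_∸ t) (1+2t≡t+1+t t)) (ℕ.m+n∸m≡n t (suc t))
      where
      1+2t≡t+1+t : ∀ t → suc (2 ℕ.* t) ≡ t ℕ.+ suc t
      1+2t≡t+1+t = solve-∀

  -- Raising t in B(m+t,2t), and splitting u(m-j) u(m+j+1).

  B-suc-suc : ∀ m t → u (suc (2 ℕ.* t)) * u (2 ℕ.+ 2 ℕ.* t) * B (suc (m ℕ.+ t)) (2 ℕ.+ 2 ℕ.* t) ≈
              u (m ∸ t) * u (suc (m ℕ.+ t)) * B (m ℕ.+ t) (2 ℕ.* t)
  B-suc-suc m t = begin
    a * b * B (suc (m ℕ.+ t)) (2 ℕ.+ 2 ℕ.* t)         ≈⟨ *-assoc _ _ _ ⟩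
    a * (b * B (suc (m ℕ.+ t)) (2 ℕ.+ 2 ℕ.* t))       ≈⟨ *-congˡ (B-suc (m ℕ.+ t) (suc (2 ℕ.* t))) ⟩
    a * (c₁ * B (m ℕ.+ t) (suc (2 ℕ.* t)))            ≈⟨ solve 3 (λ a c b → a :* (c :* b) := c :* (a :* b)) refl _ _ _ ⟩
    c₁ * (a * B (m ℕ.+ t) (suc (2 ℕ.* t)))            ≈⟨ *-congˡ (B-sucʳ (m ℕ.+ t) (2 ℕ.* t)) ⟩
    c₁ * (u (m ℕ.+ t ∸ 2 ℕ.* t) * B (m ℕ.+ t) (2 ℕ.* t)) ≈⟨ *-congˡ (*-congʳ (u-cong m+t∸2t≡m∸t)) ⟩
    c₁ * (u (m ∸ t) * B (m ℕ.+ t) (2 ℕ.* t))          ≈⟨ solve 3 (λ a c b → c :* (a :* b) := a :* c :* b) refl _ _ _ ⟩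
    u (m ∸ t) * c₁ * B (m ℕ.+ t) (2 ℕ.* t)            ∎
    where
    a b c₁ : Carrier
    a  = u (suc (2 ℕ.* t))
    b  = u (2 ℕ.+ 2 ℕ.* t)
    c₁ = u (suc (m ℕ.+ t))
    m+t∸2t≡m∸t : m ℕ.+ t ∸ 2 ℕ.* t ≡ m ∸ t
    m+t∸2t≡m∸t = ≡.trans (≡.cong₂ _∸_ (ℕ.+-comm m t) (≡.cong (t ℕ.+_) (ℕ.+-identityʳ t))) (ℕ.[m+n]∸[m+o]≡n∸o t m t)

  zero-factor : ∀ {x y z} → z ≈ 0# → x * z ≈ y * z
  zero-factor z≈0 = trans (*-congˡ z≈0) (trans (zeroʳ _) (sym (trans (*-congˡ z≈0) (zeroʳ _))))

  -- u-quadratic with s + e = m - j and s = t - j.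
  u-shift : ∀ m j c t → j ℕ.+ c ≡ t →
            u (m ∸ j) * u (suc (m ℕ.+ j)) * B (m ℕ.+ t) (2 ℕ.* t) ≈
            (q ^ (m ∸ t) * (u c * u (suc (t ℕ.+ j))) + u (m ∸ t) * u (suc (m ℕ.+ t))) * B (m ℕ.+ t) (2 ℕ.* t)
  u-shift m j c t j+c≡t with t ≤? m
  ... | no  t≰m = zero-factor (B-vanish-2* (ℕ.≰⇒> t≰m))
  ... | yes t≤m = *-congʳ (begin
    u (m ∸ j) * u (suc (m ℕ.+ j))
      ≈⟨ *-cong (u-cong m∸j≡c+e) (u-cong (≡.trans (≡.cong (λ m → suc (m ℕ.+ j)) m≡) (i₁ j c e))) ⟩
    u (c ℕ.+ e) * u (c ℕ.+ e ℕ.+ k)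
      ≈⟨ u-quadratic c e k ⟩
    u e * u (c ℕ.+ k ℕ.+ c ℕ.+ e) + q ^ e * (u c * u (c ℕ.+ k))
      ≈⟨ +-comm _ _ ⟩
    q ^ e * (u c * u (c ℕ.+ k)) + u e * u (c ℕ.+ k ℕ.+ c ℕ.+ e)
      ≈⟨ +-cong (*-congˡ (*-congˡ (u-cong (≡.trans (i₂ j c) (≡.cong (λ t → suc (t ℕ.+ j)) j+c≡t)))))
                (*-congˡ (u-cong (≡.trans (i₃ j c e) (≡.cong suc (≡.cong₂ ℕ._+_ (≡.sym m≡) j+c≡t))))) ⟩
    q ^ e * (u c * u (suc (t ℕ.+ j))) + u e * u (suc (m ℕ.+ t)) ∎)
    where
    e k : ℕ
    e = m ∸ t
    k = suc (2 ℕ.* j)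
    m≡ : m ≡ j ℕ.+ c ℕ.+ e
    m≡ = ≡.trans (≡.sym (ℕ.m+[n∸m]≡n t≤m)) (≡.cong (ℕ._+ e) (≡.sym j+c≡t))
    m∸j≡c+e : m ∸ j ≡ c ℕ.+ e
    m∸j≡c+e = ≡.trans (≡.cong (_∸ j) (≡.trans m≡ (ℕ.+-assoc j c e))) (ℕ.m+n∸m≡n j (c ℕ.+ e))
    i₁ : ∀ j c e → suc (j ℕ.+ c ℕ.+ e ℕ.+ j) ≡ c ℕ.+ e ℕ.+ suc (2 ℕ.* j)
    i₁ = solve-∀
    i₂ : ∀ j c → c ℕ.+ suc (2 ℕ.* j) ≡ suc (j ℕ.+ c ℕ.+ j)
    i₂ = solve-∀
    i₃ : ∀ j c e → c ℕ.+ suc (2 ℕ.* j) ℕ.+ c ℕ.+ e ≡ suc (j ℕ.+ c ℕ.+ e ℕ.+ (j ℕ.+ c))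
    i₃ = solve-∀

  -- The first expression.

  -- The explicit positive quotient when the parameter n of the theorem is `suc n`. The factor
  -- `1# + q ^ suc k` is u(2k+2) / u(k+1).
  value₁ : ℕ → ℕ → ℕ → Carrier
  value₁ m n k = B n k * B (suc n ℕ.+ k) k *
    (q ^ (m ∸ k) * qNum k * B (m ℕ.+ k) (2 ℕ.* k)
      + qNum (suc (2 ℕ.* k)) * (1# + q ^ suc k) * B (suc (m ℕ.+ k)) (2 ℕ.+ 2 ℕ.* k))

  value₁∈ : ∀ m n k → ℕ[q] (value₁ m n k)
  value₁∈ m n k = (B∈ n k *∈ B∈ (suc n ℕ.+ k) k) *∈
    (((^∈ (m ∸ k) *∈ qNum∈ k) *∈ B∈ (m ℕ.+ k) (2 ℕ.* k))
      +∈ ((qNum∈ (suc (2 ℕ.* k)) *∈ (1∈ +∈ ^∈ (suc k))) *∈ B∈ (suc (m ℕ.+ k)) (2 ℕ.+ 2 ℕ.* k)))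

  -- After multiplication by `u (suc k)` and `u 1` the sum in `value₁` collapses to u(m) u(m+1)
  -- B(m+k,2k). Two uses of `B-trinomial` then pass a factor B(2k,k) from the binomials in `n` to
  -- those in `m`.
  u*value₁ : ∀ m n k → u 1 * u (suc n) * value₁ m n k ≈
    u (suc n ∸ k) * u (suc k) * (B (suc n ℕ.+ k) (2 ℕ.* k) * (B (suc m) (suc k) * B (m ℕ.+ k) (suc k)))
  u*value₁ m n k = cancel k (begin
    u (suc k) * (u 1 * u (suc n) * (B n k * y * S))
      ≈⟨ solve 6 (λ a v w x y s → a :* (v :* w :* (x :* y :* s)) := w :* x :* y :* (a :* (v :* s))) refl _ _ _ _ _ _ ⟩
    u (suc n) * B n k * y * (u (suc k) * (u 1 * S))
      ≈⟨ *-cong (*-congʳ (B-sucˡ n k)) bracket ⟩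
    d * B (suc n) k * y * (u m * u (suc m) * B (m ℕ.+ k) (2 ℕ.* k))
      ≈⟨ solve 6 (λ d x y a b z → d :* x :* y :* (a :* b :* z) := d :* (y :* x) :* (a :* b :* z)) refl _ _ _ _ _ _ ⟩
    d * (y * B (suc n) k) * (u m * u (suc m) * B (m ℕ.+ k) (2 ℕ.* k))
      ≈⟨ *-congʳ (*-congˡ (B-trinomial (suc n) k)) ⟩
    d * (X * Z) * (u m * u (suc m) * B (m ℕ.+ k) (2 ℕ.* k))
      ≈⟨ solve 6 (λ d x z a b w → d :* (x :* z) :* (a :* b :* w) := d :* x :* (a :* b :* (w :* z))) refl _ _ _ _ _ _ ⟩
    d * X * (u m * u (suc m) * (B (m ℕ.+ k) (2 ℕ.* k) * Z))
      ≈⟨ *-congˡ (*-congˡ (B-trinomial m k)) ⟨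
    d * X * (u m * u (suc m) * (B (m ℕ.+ k) k * B m k))
      ≈⟨ solve 6 (λ d x a b w z → d :* x :* (a :* b :* (w :* z)) := d :* x :* ((b :* z) :* (a :* w))) refl _ _ _ _ _ _ ⟩
    d * X * ((u (suc m) * B m k) * (u m * B (m ℕ.+ k) k))
      ≈⟨ *-congˡ (*-cong (B-suc m k) (trans (B-sucʳ (m ℕ.+ k) k) (*-congʳ (u-cong (ℕ.m+n∸n≡m m k))))) ⟨
    d * X * ((u (suc k) * B (suc m) (suc k)) * (u (suc k) * B (m ℕ.+ k) (suc k)))
      ≈⟨ solve 5 (λ d x a y z → d :* x :* ((a :* y) :* (a :* z)) := a :* (d :* a :* (x :* (y :* z)))) refl _ _ _ _ _ ⟩
    u (suc k) * (d * u (suc k) * (X * (B (suc m) (suc k) * B (m ℕ.+ k) (suc k)))) ∎)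
    where
    d y S X Z w w′ : Carrier
    d = u (suc n ∸ k)
    y = B (suc n ℕ.+ k) k
    w = B (m ℕ.+ k) (2 ℕ.* k)
    w′ = B (suc (m ℕ.+ k)) (2 ℕ.+ 2 ℕ.* k)
    S = q ^ (m ∸ k) * qNum k * w + qNum (suc (2 ℕ.* k)) * (1# + q ^ suc k) * w′
    X = B (suc n ℕ.+ k) (2 ℕ.* k)
    Z = B (2 ℕ.* k) k
    double : u (suc k) * (1# + q ^ suc k) ≈ u (2 ℕ.+ 2 ℕ.* k)
    double = begin
      u (suc k) * (1# + q ^ suc k)         ≈⟨ solve 2 (λ a b → a :* (con 1 :+ b) := a :+ b :* a) refl _ _ ⟩
      u (suc k) + q ^ suc k * u (suc k)    ≈⟨ u-+ (suc k) (suc k) ⟨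
      u (suc k ℕ.+ suc k)                  ≈⟨ u-cong (2+2k k) ⟩
      u (2 ℕ.+ 2 ℕ.* k)                    ∎
      where
      2+2k : ∀ k → suc k ℕ.+ suc k ≡ 2 ℕ.+ 2 ℕ.* k
      2+2k = solve-∀
    -- With denominators cleared, the two summands of `S` are the two terms of `u-shift` at `j = 0`
    -- and `c = t = k`.
    bracket : u (suc k) * (u 1 * S) ≈ u m * u (suc m) * w
    bracket = begin
      u (suc k) * (u 1 * S)
        ≈⟨ solve 8 (λ a v p x w n r w′ → a :* (v :* (p :* x :* w :+ n :* (con 1 :+ r) :* w′))
             := p :* ((v :* x) :* a) :* w :+ (v :* n) :* (a :* (con 1 :+ r)) :* w′) refl _ _ _ _ _ _ _ _ ⟩
      q ^ (m ∸ k) * ((u 1 * qNum k) * u (suc k)) * w + (u 1 * qNum (suc (2 ℕ.* k))) * (u (suc k) * (1# + q ^ suc k)) * w′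
        ≈⟨ +-cong (*-congʳ (*-congˡ (*-congʳ (u1*qNum k)))) (*-congʳ (*-cong (u1*qNum (suc (2 ℕ.* k))) double)) ⟩
      q ^ (m ∸ k) * (u k * u (suc k)) * w + u (suc (2 ℕ.* k)) * u (2 ℕ.+ 2 ℕ.* k) * w′
        ≈⟨ +-cong (*-congʳ (*-congˡ (*-congˡ (u-cong (≡.cong suc (≡.sym (ℕ.+-identityʳ k))))))) (B-suc-suc m k) ⟩
      q ^ (m ∸ k) * (u k * u (suc (k ℕ.+ 0))) * w + u (m ∸ k) * u (suc (m ℕ.+ k)) * w
        ≈⟨ distribʳ _ _ _ ⟨
      (q ^ (m ∸ k) * (u k * u (suc (k ℕ.+ 0))) + u (m ∸ k) * u (suc (m ℕ.+ k))) * w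
        ≈⟨ u-shift m 0 k k ≡.refl ⟨
      u m * u (suc (m ℕ.+ 0)) * w
        ≈⟨ *-congʳ (*-congˡ (u-cong (≡.cong suc (ℕ.+-identityʳ m)))) ⟩
      u m * u (suc m) * w ∎

  -- The q-Saalschütz expansion for the second expression.

  sum≤ : (ℕ → Carrier) → ℕ → Carrier
  sum≤ f zero    = f 0
  sum≤ f (suc r) = sum≤ f r + f (suc r)

  sum≤∈ : ∀ {f} → (∀ s → ℕ[q] (f s)) → ∀ r → ℕ[q] (sum≤ f r)
  sum≤∈ f∈ zero    = f∈ 0
  sum≤∈ f∈ (suc r) = sum≤∈ f∈ r +∈ f∈ (suc r)

  sum≤-head : ∀ {f} → (∀ s → f (suc s) ≈ 0#) → ∀ r → sum≤ f r ≈ f 0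
  sum≤-head f≈0 zero    = refl
  sum≤-head f≈0 (suc r) = trans (+-cong (sum≤-head f≈0 r) (f≈0 r)) (+-identityʳ _)

  module _ (m k : ℕ) where

    -- The part of the summand that is free of j. The index `s` is t - k, so the range t ≥ k starts
    -- at `s = 0`.
    term : ℕ → Carrier
    term s = B (m ℕ.+ (k ℕ.+ s)) (2 ℕ.* (k ℕ.+ s)) * (catalan (k ℕ.+ s) * B (suc (k ℕ.+ s)) (suc k))

    -- Here `d` stands for k - j, so `d + s` is t - j and `j ∸ s` is j + k - t. Truncation at
    -- `s > j` is harmless: then `d + s > k` and the binomial vanishes.
    weight : ℕ → ℕ → ℕ → Carrier
    weight d j s = B k (d ℕ.+ s) * q ^ ((m ∸ (k ℕ.+ s)) ℕ.* (j ∸ s))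

    -- Stopping at `s = k` loses nothing, as `B k (d + s)` is zero beyond.
    saalschütz : ℕ → ℕ → Carrier
    saalschütz d j = sum≤ (λ s → weight d j s * term s) k

    saalschütz∈ : ∀ d j → ℕ[q] (saalschütz d j)
    saalschütz∈ d j = sum≤∈ (λ s → (B∈ k (d ℕ.+ s) *∈ ^∈ ((m ∸ (k ℕ.+ s)) ℕ.* (j ∸ s))) *∈
      (B∈ (m ℕ.+ (k ℕ.+ s)) (2 ℕ.* (k ℕ.+ s)) *∈ (ballot∈ 0 (k ℕ.+ s) *∈ B∈ (suc (k ℕ.+ s)) (suc k)))) k

    term-vanish : ∀ {s} → m < k ℕ.+ s → term s ≈ 0#
    term-vanish m<t = trans (*-congʳ (B-vanish-2* m<t)) (zeroˡ _)

    -- The j-free part of the factor split by `u-shift` carries `term s` to `term (suc s)`; this is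
    -- what makes the sum telescope.
    term-suc : ∀ s → u (m ∸ (k ℕ.+ s)) * u (suc (m ℕ.+ (k ℕ.+ s))) * term s ≈
               u (k ℕ.+ suc s) * u (suc s) * term (suc s)
    term-suc s = begin
      u (m ∸ t) * u (suc (m ℕ.+ t)) * (B (m ℕ.+ t) (2 ℕ.* t) * (catalan t * b))
        ≈⟨ *-assoc _ _ _ ⟨
      u (m ∸ t) * u (suc (m ℕ.+ t)) * B (m ℕ.+ t) (2 ℕ.* t) * (catalan t * b)
        ≈⟨ *-congʳ (B-suc-suc m t) ⟨
      v * w * x * (catalan t * b)
        ≈⟨ solve 5 (λ v w x c b → v :* w :* x :* (c :* b) := x :* ((v :* w :* c) :* b)) refl _ _ _ _ _ ⟩
      x * (v * w * catalan t * b)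
        ≈⟨ *-congˡ (*-congʳ (catalan-suc t)) ⟩
      x * (u (suc t) * u (2 ℕ.+ t) * catalan (suc t) * b)
        ≈⟨ solve 5 (λ x a c d b → x :* (a :* c :* d :* b) := a :* x :* d :* (c :* b)) refl _ _ _ _ _ ⟩
      u (suc t) * x * catalan (suc t) * (u (2 ℕ.+ t) * b)
        ≈⟨ *-congˡ (trans (B-sucˡ (suc t) (suc k)) (*-congʳ (u-cong 1+t∸k≡1+s))) ⟩
      u (suc t) * x * catalan (suc t) * (u (suc s) * B (2 ℕ.+ t) (suc k))
        ≈⟨ solve 5 (λ a x c b y → a :* x :* c :* (b :* y) := a :* b :* (x :* (c :* y))) refl _ _ _ _ _ ⟩
      u (suc t) * u (suc s) * (x * (catalan (suc t) * B (2 ℕ.+ t) (suc k)))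
        ≈⟨ *-congˡ (*-congʳ (B-cong (≡.sym (ℕ.+-suc m t)) (≡.sym (ℕ.*-suc 2 t)))) ⟩
      u (suc t) * u (suc s) * (B (m ℕ.+ suc t) (2 ℕ.* suc t) * (catalan (suc t) * B (suc (suc t)) (suc k)))
        ≈⟨ reflexive (≡.cong (λ t → u t * u (suc s) * (B (m ℕ.+ t) (2 ℕ.* t) * (catalan t * B (suc t) (suc k)))) (≡.sym (ℕ.+-suc k s))) ⟩
      u (k ℕ.+ suc s) * u (suc s) * term (suc s) ∎
      where
      t : ℕ
      t = k ℕ.+ s
      b v w x : Carrier
      b = B (suc t) (suc k)
      v = u (suc (2 ℕ.* t))
      w = u (2 ℕ.+ 2 ℕ.* t)
      x = B (suc (m ℕ.+ t)) (2 ℕ.+ 2 ℕ.* t)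
      1+t∸k≡1+s : suc t ∸ k ≡ suc s
      1+t∸k≡1+s = ≡.trans (≡.cong (_∸ k) (≡.sym (ℕ.+-suc k s))) (ℕ.m+n∸m≡n k (suc s))

    -- This is `weight (suc d) j` at s - 1, by a formula that still makes sense at `s = 0`, where it
    -- will be multiplied by `u 0`.
    weight⁻ : ℕ → ℕ → ℕ → Carrier
    weight⁻ d j s = B k (d ℕ.+ s) * q ^ ((suc m ∸ (k ℕ.+ s)) ℕ.* (suc j ∸ s))

    weight⁻-suc : ∀ d j s → weight⁻ d j (suc s) ≈ weight (suc d) j s
    weight⁻-suc d j s = *-cong (B-cong (≡.refl {x = k}) (ℕ.+-suc d s))
      (reflexive (≡.cong (λ t → q ^ ((suc m ∸ t) ℕ.* (j ∸ s))) (ℕ.+-suc k s)))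

    module _ (j d : ℕ) (j+1+d≡k : j ℕ.+ suc d ≡ k) where

      factor factor′ : Carrier
      factor  = u (m ∸ j) * u (suc (m ℕ.+ j))
      factor′ = u (suc (k ℕ.+ j)) * u (suc j)

      -- The part of `factor` that stays at index `s` when `u-shift` splits it; `suc d + s` is t -
      -- j.
      spread : ℕ → Carrier
      spread s = q ^ (m ∸ (k ℕ.+ s)) * (u (suc d ℕ.+ s) * u (suc (k ℕ.+ s ℕ.+ j)))

      factor-term : ∀ s → factor * (weight (suc d) j s * term s) ≈
        spread s * weight (suc d) j s * term s
          + weight (suc d) j s * (u (k ℕ.+ suc s) * u (suc s) * term (suc s))
      factor-term s = begin
        factor * (W * (b * c₁))
          ≈⟨ solve 4 (λ a w b c → a :* (w :* (b :* c)) := w :* (a :* b) :* c) refl _ _ _ _ ⟩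
        W * (factor * b) * c₁
          ≈⟨ *-congʳ (*-congˡ (u-shift m j (suc d ℕ.+ s) t j+1+d+s≡t)) ⟩
        W * ((spread s + z) * b) * c₁
          ≈⟨ solve 5 (λ w y z b c → w :* ((y :+ z) :* b) :* c := y :* w :* (b :* c) :+ w :* (z :* (b :* c))) refl _ _ _ _ _ ⟩
        spread s * W * term s + W * (z * term s)
          ≈⟨ +-congˡ (*-congˡ (term-suc s)) ⟩
        spread s * W * term s + W * (u (k ℕ.+ suc s) * u (suc s) * term (suc s)) ∎
        where
        t : ℕ
        t = k ℕ.+ s
        W b c₁ z : Carrier
        W  = weight (suc d) j s
        b  = B (m ℕ.+ t) (2 ℕ.* t)
        c₁ = catalan t * B (suc t) (suc k)
        z  = u (m ∸ t) * u (suc (m ℕ.+ t))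
        j+1+d+s≡t : j ℕ.+ (suc d ℕ.+ s) ≡ t
        j+1+d+s≡t = ≡.trans (≡.sym (ℕ.+-assoc j (suc d) s)) (≡.cong (ℕ._+ s) j+1+d≡k)

      -- Both summands are multiples of `weight d (suc j) s`, and their cofactors add up to
      -- `factor′` by `u-quadratic` with e = j + 1 - s.
      combine-weights : ∀ s → k ℕ.+ s ≤ m →
        spread s * weight (suc d) j s + weight⁻ d j s * (u (k ℕ.+ s) * u s) ≈ factor′ * weight d (suc j) s
      combine-weights s t≤m with s ≤? suc j
      ... | no s≰1+j = trans
        (+-cong (trans (*-congˡ (trans (*-congʳ (B-vanish (ℕ.m<n⇒m<1+n k<d+s))) (zeroˡ _))) (zeroʳ _))
                (trans (*-congʳ (trans (*-congʳ (B-vanish k<d+s)) (zeroˡ _))) (zeroˡ _)))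
        (trans (+-identityʳ _) (sym (trans (*-congˡ (trans (*-congʳ (B-vanish k<d+s)) (zeroˡ _))) (zeroʳ _))))
        where
        k<d+s : k < d ℕ.+ s
        k<d+s = ≡.subst (_< d ℕ.+ s) (≡.trans (swap d j) j+1+d≡k) (ℕ.+-monoʳ-< d (ℕ.≰⇒> s≰1+j))
          where
          swap : ∀ d j → d ℕ.+ suc j ≡ j ℕ.+ suc d
          swap = solve-∀
      ... | yes s≤1+j = begin
        q ^ M * (u (suc d ℕ.+ s) * v) * (B k (suc d ℕ.+ s) * q ^ (M ℕ.* (j ∸ s))) + weight⁻ d j s * (u t * u s)
          ≈⟨ +-cong
               (solve 5 (λ p a v b r → p :* (a :* v) :* (b :* r) := (a :* b) :* (p :* r) :* v) refl _ _ _ _ _)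
               (*-congʳ (*-congˡ (trans (reflexive (≡.cong (λ M → q ^ (M ℕ.* e)) (ℕ.+-∸-assoc 1 t≤m))) (^-homo-* q e (M ℕ.* e))))) ⟩
        (u (suc d ℕ.+ s) * B k (suc d ℕ.+ s)) * (q ^ M * q ^ (M ℕ.* (j ∸ s))) * v + b * (q ^ e * r) * (u t * u s)
          ≈⟨ +-congʳ (*-congʳ (*-congʳ (trans (B-sucʳ k (d ℕ.+ s)) (*-congʳ (u-cong k∸[d+s]≡e))))) ⟩
        (u e * b) * (q ^ M * q ^ (M ℕ.* (j ∸ s))) * v + b * (q ^ e * r) * (u t * u s)
          ≈⟨ +-congʳ (*-congʳ (solve 3 (λ a b c → (a :* b) :* c := b :* (a :* c)) refl _ _ _)) ⟩
        b * (u e * (q ^ M * q ^ (M ℕ.* (j ∸ s)))) * v + b * (q ^ e * r) * (u t * u s)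
          ≈⟨ +-congʳ (*-congʳ (*-congˡ (exponent e ≡.refl))) ⟩
        b * (u e * r) * v + b * (q ^ e * r) * (u t * u s)
          ≈⟨ solve 7 (λ b a r v p x y → b :* (a :* r) :* v :+ b :* (p :* r) :* (x :* y)
                       := (a :* v :+ p :* (y :* x)) :* (b :* r)) refl _ _ _ _ _ _ _ ⟩
        (u e * v + q ^ e * (u s * u t)) * (b * r)
          ≈⟨ *-congʳ quadratic ⟩
        factor′ * (b * r) ∎
        where
        t M e : ℕ
        t = k ℕ.+ s
        M = m ∸ t
        e = suc j ∸ s
        s+e≡1+j : s ℕ.+ e ≡ suc j
        s+e≡1+j = ℕ.m+[n∸m]≡n s≤1+j
        v b r : Carrier
        v = u (suc (t ℕ.+ j))
        b = B k (d ℕ.+ s)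
        r = q ^ (M ℕ.* e)
        k∸[d+s]≡e : k ∸ (d ℕ.+ s) ≡ e
        k∸[d+s]≡e = ≡.trans (≡.cong (_∸ (d ℕ.+ s)) (≡.trans (≡.sym j+1+d≡k) (swap d j))) (ℕ.[m+n]∸[m+o]≡n∸o d (suc j) s)
          where
          swap : ∀ d j → j ℕ.+ suc d ≡ d ℕ.+ suc j
          swap = solve-∀
        -- At `e = 0`, that is s = j + 1, the truncated `j ∸ s` spoils the law of exponents, but the
        -- factor `u 0` vanishes.
        exponent : ∀ i → i ≡ e → u i * (q ^ M * q ^ (M ℕ.* (j ∸ s))) ≈ u i * q ^ (M ℕ.* i)
        exponent zero    _     = trans (trans (*-congʳ u0≈0) (zeroˡ _)) (sym (trans (*-congʳ u0≈0) (zeroˡ _)))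
        exponent (suc i) 1+i≡e = *-congˡ (trans (sym (^-homo-* q M (M ℕ.* (j ∸ s))))
          (reflexive (≡.cong (q ^_) (≡.trans (≡.cong (λ x → M ℕ.+ M ℕ.* x) j∸s≡i) (≡.sym (ℕ.*-suc M i))))))
          where
          j∸s≡i : j ∸ s ≡ i
          j∸s≡i = ≡.trans (≡.cong (_∸ s) (ℕ.suc-injective (≡.trans (≡.sym s+e≡1+j)
                    (≡.trans (≡.cong (s ℕ.+_) (≡.sym 1+i≡e)) (ℕ.+-suc s i))))) (ℕ.m+n∸m≡n s i)
        quadratic : u e * v + q ^ e * (u s * u t) ≈ factor′
        quadratic = begin
          u e * v + q ^ e * (u s * u t)
            ≈⟨ +-cong (*-congˡ (u-cong v≡)) (*-congˡ (*-congˡ (u-cong (ℕ.+-comm k s)))) ⟩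
          u e * u (s ℕ.+ k ℕ.+ s ℕ.+ e) + q ^ e * (u s * u (s ℕ.+ k))
            ≈⟨ u-quadratic s e k ⟨
          u (s ℕ.+ e) * u (s ℕ.+ e ℕ.+ k)
            ≈⟨ *-cong (u-cong s+e≡1+j) (u-cong (≡.trans (≡.cong (ℕ._+ k) s+e≡1+j) (≡.cong suc (ℕ.+-comm j k)))) ⟩
          u (suc j) * u (suc (k ℕ.+ j))
            ≈⟨ *-comm _ _ ⟩
          factor′ ∎
          where
          v≡ : suc (t ℕ.+ j) ≡ s ℕ.+ k ℕ.+ s ℕ.+ e
          v≡ = ≡.trans (≡.sym (ℕ.+-suc t j)) (≡.trans (≡.cong₂ ℕ._+_ (ℕ.+-comm k s) (≡.sym s+e≡1+j)) (≡.sym (ℕ.+-assoc (s ℕ.+ k) s e)))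

      -- Extends `combine-weights` beyond `k + s ≤ m`, where `term s` is zero.
      combine : ∀ s → spread s * weight (suc d) j s * term s + weight⁻ d j s * (u (k ℕ.+ s) * u s * term s) ≈
                factor′ * (weight d (suc j) s * term s)
      combine s with k ℕ.+ s ≤? m
      ... | no t≰m = trans
        (+-cong (trans (*-congˡ t≈0) (zeroʳ _)) (trans (*-congˡ (trans (*-congˡ t≈0) (zeroʳ _))) (zeroʳ _)))
        (trans (+-identityʳ _) (sym (trans (*-congˡ (trans (*-congˡ t≈0) (zeroʳ _))) (zeroʳ _))))
        where
        t≈0 : term s ≈ 0#
        t≈0 = term-vanish {s} (ℕ.≰⇒> t≰m)
      ... | yes t≤m = begin
        spread s * weight (suc d) j s * term s + weight⁻ d j s * (u (k ℕ.+ s) * u s * term s)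
          ≈⟨ solve 4 (λ x w z t → x :* t :+ w :* (z :* t) := (x :+ w :* z) :* t) refl _ _ _ _ ⟩
        (spread s * weight (suc d) j s + weight⁻ d j s * (u (k ℕ.+ s) * u s)) * term s
          ≈⟨ *-congʳ (combine-weights s t≤m) ⟩
        factor′ * weight d (suc j) s * term s
          ≈⟨ *-assoc _ _ _ ⟩
        factor′ * (weight d (suc j) s * term s) ∎

      -- The last summand on the right is the share of index `r` that has moved to `r + 1`. The next
      -- step takes it up through `weight⁻-suc` and `combine`.
      telescope : ∀ r → factor * sum≤ (λ s → weight (suc d) j s * term s) r ≈
        factor′ * sum≤ (λ s → weight d (suc j) s * term s) r
          + weight (suc d) j r * (u (k ℕ.+ suc r) * u (suc r) * term (suc r))
      telescope zero    = begin
        factor * (weight (suc d) j 0 * term 0)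
          ≈⟨ factor-term 0 ⟩
        x + y
          ≈⟨ +-congʳ (+-identityʳ x) ⟨
        x + 0# + y
          -- The zero is written as a share arriving at index 0, which carries the factor `u 0`, so
          -- that `combine` applies at `s = 0`.
          ≈⟨ +-congʳ (+-congˡ (trans (*-congˡ (trans (*-congʳ (trans (*-congˡ u0≈0) (zeroʳ _))) (zeroˡ _))) (zeroʳ _))) ⟨
        x + weight⁻ d j 0 * (u (k ℕ.+ 0) * u 0 * term 0) + y
          ≈⟨ +-congʳ (combine 0) ⟩
        factor′ * (weight d (suc j) 0 * term 0) + y ∎
        where
        x y : Carrier
        x = spread 0 * weight (suc d) j 0 * term 0
        y = weight (suc d) j 0 * (u (k ℕ.+ 1) * u 1 * term 1)
      telescope (suc r) = begin
        factor * (S + weight (suc d) j (suc r) * term (suc r))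
          ≈⟨ distribˡ _ _ _ ⟩
        factor * S + factor * (weight (suc d) j (suc r) * term (suc r))
          ≈⟨ +-cong (telescope r) (factor-term (suc r)) ⟩
        factor′ * S′ + weight (suc d) j r * z + (x + y)
          ≈⟨ solve 4 (λ a b x y → a :+ b :+ (x :+ y) := a :+ (x :+ b) :+ y) refl _ _ _ _ ⟩
        factor′ * S′ + (x + weight (suc d) j r * z) + y
          ≈⟨ +-congʳ (+-congˡ (+-congˡ (*-congʳ (weight⁻-suc d j r)))) ⟨
        factor′ * S′ + (x + weight⁻ d j (suc r) * z) + y
          ≈⟨ +-congʳ (+-congˡ (combine (suc r))) ⟩
        factor′ * S′ + factor′ * (weight d (suc j) (suc r) * term (suc r)) + y
          ≈⟨ +-congʳ (distribˡ _ _ _) ⟨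
        factor′ * (S′ + weight d (suc j) (suc r) * term (suc r)) + y ∎
        where
        S S′ x y z : Carrier
        S  = sum≤ (λ s → weight (suc d) j s * term s) r
        S′ = sum≤ (λ s → weight d (suc j) s * term s) r
        x  = spread (suc r) * weight (suc d) j (suc r) * term (suc r)
        y  = weight (suc d) j (suc r) * (u (k ℕ.+ suc (suc r)) * u (suc (suc r)) * term (suc (suc r)))
        z  = u (k ℕ.+ suc r) * u (suc r) * term (suc r)

      saalschütz-suc : factor * saalschütz (suc d) j ≈ factor′ * saalschütz d (suc j)
      -- At `r = k` the boundary term contains `B k (suc d + k)`, which is zero.
      saalschütz-suc = trans (telescope k) (trans (+-congˡ
        (trans (*-congʳ (trans (*-congʳ (B-vanish (s≤s (ℕ.m≤n+m k d)))) (zeroˡ _))) (zeroˡ _))) (+-identityʳ _))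

    -- The base case `j = 0`: since `d = k`, only `s = 0` survives, and `u*catalan` evaluates it.
    saalschütz-zero : u (suc k) * saalschütz k 0 ≈ u 1 * (B (2 ℕ.* k) k * B (m ℕ.+ k) (2 ℕ.* k))
    saalschütz-zero = begin
      u (suc k) * saalschütz k 0
        ≈⟨ *-congˡ (sum≤-head (λ s → trans (*-congʳ (trans (*-congʳ (B-vanish (k<k+1+s s))) (zeroˡ _))) (zeroˡ _)) k) ⟩
      u (suc k) * (weight k 0 0 * term 0)
        ≈⟨ *-congˡ (*-cong weight≈1 term≈) ⟩
      u (suc k) * (1# * (B (m ℕ.+ k) (2 ℕ.* k) * (catalan k * 1#)))
        ≈⟨ solve 3 (λ a b c → a :* (con 1 :* (b :* (c :* con 1))) := (a :* c) :* b) refl _ _ _ ⟩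
      u (suc k) * catalan k * B (m ℕ.+ k) (2 ℕ.* k)
        ≈⟨ *-congʳ (u*catalan k) ⟩
      u 1 * B (2 ℕ.* k) k * B (m ℕ.+ k) (2 ℕ.* k)
        ≈⟨ *-assoc _ _ _ ⟩
      u 1 * (B (2 ℕ.* k) k * B (m ℕ.+ k) (2 ℕ.* k)) ∎
      where
      k<k+1+s : ∀ s → k < k ℕ.+ suc s
      k<k+1+s s = ℕ.m<m+n k ℕ.z<s
      weight≈1 : weight k 0 0 ≈ 1#
      weight≈1 = trans (*-cong (trans (B-cong (≡.refl {x = k}) (ℕ.+-identityʳ k)) (B-diag k))
        (reflexive (≡.cong (q ^_) (ℕ.*-zeroʳ (m ∸ (k ℕ.+ 0)))))) (*-identityˡ _)
      term≈ : term 0 ≈ B (m ℕ.+ k) (2 ℕ.* k) * (catalan k * 1#)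
      term≈ = trans (reflexive (≡.cong (λ t → B (m ℕ.+ t) (2 ℕ.* t) * (catalan t * B (suc t) (suc k))) (ℕ.+-identityʳ k)))
        (*-congˡ (*-congˡ (B-diag (suc k))))

    binoms₂ : ℕ → Carrier
    binoms₂ j = B (2 ℕ.* k) (j ℕ.+ k) * B (m ℕ.+ k) (2 ℕ.* k) * B m j * B (m ℕ.+ j) j

    -- One absorption for each of the three binomials that depend on `j`. The factors are those of
    -- `saalschütz-suc` together with those from passing from `B k j` to `B k (suc j)`.
    binoms₂-suc : ∀ j → u (suc (k ℕ.+ j)) * u (suc j) * u (suc j) * binoms₂ (suc j) ≈
                 u (k ∸ j) * (u (m ∸ j) * u (suc (m ℕ.+ j))) * binoms₂ j
    binoms₂-suc j = begin
      u (suc (k ℕ.+ j)) * u (suc j) * u (suc j) * (b₁ * b₂ * b₃ * b₄)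
        ≈⟨ solve 6 (λ x y a b c d → x :* y :* y :* (a :* b :* c :* d) := (x :* a) :* b :* (y :* c) :* (y :* d)) refl _ _ _ _ _ _ ⟩
      (u (suc (k ℕ.+ j)) * b₁) * b₂ * (u (suc j) * b₃) * (u (suc j) * b₄)
        ≈⟨ *-cong (*-cong (*-congʳ eq₁) (B-sucʳ m j))
             (trans (*-congˡ (B-congˡ (suc j) (ℕ.+-suc m j))) (B-suc (m ℕ.+ j) j)) ⟩
      (u (k ∸ j) * B (2 ℕ.* k) (j ℕ.+ k)) * b₂ * (u (m ∸ j) * B m j) * (u (suc (m ℕ.+ j)) * B (m ℕ.+ j) j)
        ≈⟨ solve 7 (λ x y z a b c d → (x :* a) :* b :* (y :* c) :* (z :* d)
                     := x :* (y :* z) :* (a :* b :* c :* d)) refl _ _ _ _ _ _ _ ⟩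
      u (k ∸ j) * (u (m ∸ j) * u (suc (m ℕ.+ j))) * binoms₂ j ∎
      where
      b₁ b₂ b₃ b₄ : Carrier
      b₁ = B (2 ℕ.* k) (suc j ℕ.+ k)
      b₂ = B (m ℕ.+ k) (2 ℕ.* k)
      b₃ = B m (suc j)
      b₄ = B (m ℕ.+ suc j) (suc j)
      2k∸[j+k]≡k∸j : 2 ℕ.* k ∸ (j ℕ.+ k) ≡ k ∸ j
      2k∸[j+k]≡k∸j = ≡.trans (≡.cong₂ _∸_ (≡.cong (k ℕ.+_) (ℕ.+-identityʳ k)) (ℕ.+-comm j k)) (ℕ.[m+n]∸[m+o]≡n∸o k k j)
      eq₁ : u (suc (k ℕ.+ j)) * b₁ ≈ u (k ∸ j) * B (2 ℕ.* k) (j ℕ.+ k)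
      eq₁ = trans (*-congʳ (u-cong (≡.cong suc (ℕ.+-comm k j))))
        (trans (B-sucʳ (2 ℕ.* k) (j ℕ.+ k)) (*-congʳ (u-cong 2k∸[j+k]≡k∸j)))

    -- By induction on `j`, with `d` falling as `j` rises: both sides satisfy the same first-order
    -- recurrence, and its leading factors cancel.
    u*saalschütz : ∀ j d → j ℕ.+ d ≡ k → u (suc k) * (B k j * saalschütz d j) ≈ u 1 * binoms₂ j
    u*saalschütz zero    d ≡.refl = begin
      u (suc k) * (1# * saalschütz k 0)                            ≈⟨ *-congˡ (*-identityˡ _) ⟩
      u (suc k) * saalschütz k 0                                   ≈⟨ saalschütz-zero ⟩
      u 1 * (B (2 ℕ.* k) k * B (m ℕ.+ k) (2 ℕ.* k))                ≈⟨ *-congˡ (trans (*-identityʳ _) (*-identityʳ _)) ⟨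
      u 1 * binoms₂ 0                                               ∎
    u*saalschütz (suc j) d 1+j+d≡k = cancel (k ℕ.+ j) (cancel j (cancel j (begin
      a * (a * (c₁ * (u (suc k) * (B k (suc j) * saalschütz d (suc j)))))
        ≈⟨ solve 5 (λ a c k b s → a :* (a :* (c :* (k :* (b :* s)))) := k :* ((a :* b) :* (c :* a :* s))) refl _ _ _ _ _ ⟩
      u (suc k) * ((a * B k (suc j)) * (c₁ * a * saalschütz d (suc j)))
        ≈⟨ *-congˡ (*-cong (B-sucʳ k j) (sym (saalschütz-suc j d j+1+d≡k))) ⟩
      u (suc k) * ((u (k ∸ j) * B k j) * (s * saalschütz (suc d) j))
        ≈⟨ solve 5 (λ k x b y s → k :* ((x :* b) :* (y :* s)) := x :* y :* (k :* (b :* s))) refl _ _ _ _ _ ⟩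
      u (k ∸ j) * s * (u (suc k) * (B k j * saalschütz (suc d) j))
        ≈⟨ *-congˡ (u*saalschütz j (suc d) j+1+d≡k) ⟩
      u (k ∸ j) * s * (u 1 * binoms₂ j)
        ≈⟨ solve 3 (λ x v y → x :* (v :* y) := v :* (x :* y)) refl _ _ _ ⟩
      u 1 * (u (k ∸ j) * s * binoms₂ j)
        ≈⟨ *-congˡ (binoms₂-suc j) ⟨
      u 1 * (c₁ * a * a * binoms₂ (suc j))
        ≈⟨ solve 4 (λ v c a y → v :* (c :* a :* a :* y) := a :* (a :* (c :* (v :* y)))) refl _ _ _ _ ⟩
      a * (a * (c₁ * (u 1 * binoms₂ (suc j)))) ∎)))
      where
      a c₁ s : Carrier
      a  = u (suc j)
      c₁ = u (suc (k ℕ.+ j))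
      s  = u (m ∸ j) * u (suc (m ℕ.+ j))
      j+1+d≡k : j ℕ.+ suc d ≡ k
      j+1+d≡k = ≡.trans (ℕ.+-suc j d) 1+j+d≡k

-- The commutative ring of coefficient lists.

infix 4 _≋_

-- A record, unlike _≈P_, lets p and r be inferred from a proof of p ≋ r.
record _≋_ (p r : Poly) : Set where
  constructor ⟪_⟫
  field at : p ≈P r
open _≋_

≋-isEquivalence : IsEquivalence _≋_
≋-isEquivalence = record
  { refl  = ⟪ (λ _ → ≡.refl) ⟫
  ; sym   = λ p≋r → ⟪ (λ i → ≡.sym (at p≋r i)) ⟫
  ; trans = λ p≋r r≋s → ⟪ (λ i → ≡.trans (at p≋r i) (at r≋s i)) ⟫
  }

≋-setoid : Setoid 0ℓ 0ℓ
≋-setoid = record { isEquivalence = ≋-isEquivalence }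

open IsEquivalence ≋-isEquivalence using () renaming (refl to ≋-refl; sym to ≋-sym; trans to ≋-trans)

∷-cong : ∀ {a b p r} → a ≡ b → p ≋ r → a ∷ p ≋ b ∷ r
∷-cong a≡b p≋r = ⟪ (λ { zero → a≡b ; (suc i) → at p≋r i }) ⟫

0∷[]≋[] : + 0 ∷ [] ≋ []
0∷[]≋[] = ⟪ (λ { zero → ≡.refl ; (suc i) → ≡.refl }) ⟫

scale : ℤ → Poly → Poly
scale a = map (a ℤ.*_)

coeff-+P : ∀ p r i → coeff (p +P r) i ≡ coeff p i ℤ.+ coeff r i
coeff-+P []      r       i       = ≡.sym (ℤ.+-identityˡ _)
coeff-+P (a ∷ p) []      i       = ≡.sym (ℤ.+-identityʳ _)
coeff-+P (a ∷ p) (b ∷ r) zero    = ≡.refl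
coeff-+P (a ∷ p) (b ∷ r) (suc i) = coeff-+P p r i

coeff-negP : ∀ p i → coeff (negP p) i ≡ ℤ.- coeff p i
coeff-negP []      i       = ≡.refl
coeff-negP (a ∷ p) zero    = ≡.refl
coeff-negP (a ∷ p) (suc i) = coeff-negP p i

coeff-scale : ∀ a p i → coeff (scale a p) i ≡ a ℤ.* coeff p i
coeff-scale a []      i       = ≡.sym (ℤ.*-zeroʳ a)
coeff-scale a (b ∷ p) zero    = ≡.refl
coeff-scale a (b ∷ p) (suc i) = coeff-scale a p i

+P-cong : ∀ {p p′ r r′} → p ≋ p′ → r ≋ r′ → p +P r ≋ p′ +P r′
+P-cong {p} {p′} {r} {r′} p≋p′ r≋r′ = ⟪ (λ i → ≡.trans (coeff-+P p r i)
  (≡.trans (≡.cong₂ ℤ._+_ (at p≋p′ i) (at r≋r′ i)) (≡.sym (coeff-+P p′ r′ i)))) ⟫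

+P-assoc : ∀ p r s → (p +P r) +P s ≋ p +P (r +P s)
+P-assoc p r s = ⟪ (λ i → begin
  coeff (p +P r +P s) i                         ≡⟨ coeff-+P (p +P r) s i ⟩
  coeff (p +P r) i ℤ.+ coeff s i                ≡⟨ ≡.cong (ℤ._+ coeff s i) (coeff-+P p r i) ⟩
  coeff p i ℤ.+ coeff r i ℤ.+ coeff s i         ≡⟨ ℤ.+-assoc (coeff p i) (coeff r i) (coeff s i) ⟩
  coeff p i ℤ.+ (coeff r i ℤ.+ coeff s i)       ≡⟨ ≡.cong (λ z → coeff p i ℤ.+ z) (coeff-+P r s i) ⟨
  coeff p i ℤ.+ coeff (r +P s) i                ≡⟨ coeff-+P p (r +P s) i ⟨
  coeff (p +P (r +P s)) i                       ∎) ⟫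
  where open ≡.≡-Reasoning

+P-comm : ∀ p r → p +P r ≋ r +P p
+P-comm p r = ⟪ (λ i → ≡.trans (coeff-+P p r i)
  (≡.trans (ℤ.+-comm (coeff p i) (coeff r i)) (≡.sym (coeff-+P r p i)))) ⟫

+P-identityʳ : ∀ p → p +P [] ≋ p
+P-identityʳ p = +P-comm p []

negP-cong : ∀ {p r} → p ≋ r → negP p ≋ negP r
negP-cong {p} {r} p≋r = ⟪ (λ i → ≡.trans (coeff-negP p i)
  (≡.trans (≡.cong ℤ.-_ (at p≋r i)) (≡.sym (coeff-negP r i)))) ⟫

negP-inverseʳ : ∀ p → p +P negP p ≋ []
negP-inverseʳ p = ⟪ (λ i → ≡.trans (coeff-+P p (negP p) i)
  (≡.trans (≡.cong (λ z → coeff p i ℤ.+ z) (coeff-negP p i)) (ℤ.+-inverseʳ (coeff p i)))) ⟫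

scale-cong : ∀ a {p r} → p ≋ r → scale a p ≋ scale a r
scale-cong a {p} {r} p≋r = ⟪ (λ i → ≡.trans (coeff-scale a p i)
  (≡.trans (≡.cong (a ℤ.*_) (at p≋r i)) (≡.sym (coeff-scale a r i)))) ⟫

scale-zero : ∀ p → scale (+ 0) p ≋ []
scale-zero p = ⟪ coeff-scale (+ 0) p ⟫

scale-one : ∀ p → scale (+ 1) p ≋ p
scale-one p = ⟪ (λ i → ≡.trans (coeff-scale (+ 1) p i) (ℤ.*-identityˡ _)) ⟫

scale-+ : ∀ a b p → scale (a ℤ.+ b) p ≋ scale a p +P scale b p
scale-+ a b p = ⟪ (λ i → begin
  coeff (scale (a ℤ.+ b) p) i                     ≡⟨ coeff-scale (a ℤ.+ b) p i ⟩
  (a ℤ.+ b) ℤ.* coeff p i                         ≡⟨ ℤ.*-distribʳ-+ (coeff p i) a b ⟩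
  a ℤ.* coeff p i ℤ.+ b ℤ.* coeff p i             ≡⟨ ≡.cong₂ ℤ._+_ (coeff-scale a p i) (coeff-scale b p i) ⟨
  coeff (scale a p) i ℤ.+ coeff (scale b p) i     ≡⟨ coeff-+P (scale a p) (scale b p) i ⟨
  coeff (scale a p +P scale b p) i                ∎) ⟫
  where open ≡.≡-Reasoning

scale-+P : ∀ a p r → scale a (p +P r) ≋ scale a p +P scale a r
scale-+P a p r = ⟪ (λ i → begin
  coeff (scale a (p +P r)) i                      ≡⟨ coeff-scale a (p +P r) i ⟩
  a ℤ.* coeff (p +P r) i                          ≡⟨ ≡.cong (a ℤ.*_) (coeff-+P p r i) ⟩
  a ℤ.* (coeff p i ℤ.+ coeff r i)                 ≡⟨ ℤ.*-distribˡ-+ a (coeff p i) (coeff r i) ⟩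
  a ℤ.* coeff p i ℤ.+ a ℤ.* coeff r i             ≡⟨ ≡.cong₂ ℤ._+_ (coeff-scale a p i) (coeff-scale a r i) ⟨
  coeff (scale a p) i ℤ.+ coeff (scale a r) i     ≡⟨ coeff-+P (scale a p) (scale a r) i ⟨
  coeff (scale a p +P scale a r) i                ∎) ⟫
  where open ≡.≡-Reasoning

scale-scale : ∀ a b p → scale a (scale b p) ≋ scale (a ℤ.* b) p
scale-scale a b p = ⟪ (λ i → begin
  coeff (scale a (scale b p)) i  ≡⟨ coeff-scale a (scale b p) i ⟩
  a ℤ.* coeff (scale b p) i      ≡⟨ ≡.cong (a ℤ.*_) (coeff-scale b p i) ⟩
  a ℤ.* (b ℤ.* coeff p i)        ≡⟨ ℤ.*-assoc a b (coeff p i) ⟨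
  a ℤ.* b ℤ.* coeff p i          ≡⟨ coeff-scale (a ℤ.* b) p i ⟨
  coeff (scale (a ℤ.* b) p) i    ∎) ⟫
  where open ≡.≡-Reasoning

open SetoidReasoning ≋-setoid

+P-interchange : ∀ p r s t → (p +P r) +P (s +P t) ≋ (p +P s) +P (r +P t)
+P-interchange p r s t = begin
  (p +P r) +P (s +P t)  ≈⟨ +P-assoc p r (s +P t) ⟩
  p +P (r +P (s +P t))  ≈⟨ +P-cong (≋-refl {p}) (≋-sym (+P-assoc r s t)) ⟩
  p +P ((r +P s) +P t)  ≈⟨ +P-cong (≋-refl {p}) (+P-cong (+P-comm r s) (≋-refl {t})) ⟩
  p +P ((s +P r) +P t)  ≈⟨ +P-cong (≋-refl {p}) (+P-assoc s r t) ⟩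
  p +P (s +P (r +P t))  ≈⟨ +P-assoc p s (r +P t) ⟨
  (p +P s) +P (r +P t)  ∎

*P-zeroʳ : ∀ p → p *P [] ≋ []
*P-zeroʳ []      = ≋-refl
*P-zeroʳ (a ∷ p) = ≋-trans (∷-cong ≡.refl (*P-zeroʳ p)) 0∷[]≋[]

*P-congˡ : ∀ p {r r′} → r ≋ r′ → p *P r ≋ p *P r′
*P-congˡ []      r≋r′ = ≋-refl
*P-congˡ (a ∷ p) r≋r′ = +P-cong (scale-cong a r≋r′) (∷-cong ≡.refl (*P-congˡ p r≋r′))

-- The recursion of the product mirrored in its right argument; commutativity follows from it.
*P-∷ʳ : ∀ p b r → p *P (b ∷ r) ≋ scale b p +P (+ 0 ∷ p *P r)
*P-∷ʳ []      b r = ≋-sym 0∷[]≋[]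
*P-∷ʳ (a ∷ p) b r = ∷-cong (≡.cong (ℤ._+ + 0) (ℤ.*-comm a b)) (begin
  scale a r +P p *P (b ∷ r)                        ≈⟨ +P-cong (≋-refl {scale a r}) (*P-∷ʳ p b r) ⟩
  scale a r +P (scale b p +P (+ 0 ∷ p *P r))       ≈⟨ +P-assoc (scale a r) (scale b p) _ ⟨
  (scale a r +P scale b p) +P (+ 0 ∷ p *P r)       ≈⟨ +P-cong (+P-comm (scale a r) (scale b p)) ≋-refl ⟩
  (scale b p +P scale a r) +P (+ 0 ∷ p *P r)       ≈⟨ +P-assoc (scale b p) (scale a r) _ ⟩
  scale b p +P (scale a r +P (+ 0 ∷ p *P r))       ∎)

*P-comm : ∀ p r → p *P r ≋ r *P p
*P-comm []      r = ≋-sym (*P-zeroʳ r)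
*P-comm (a ∷ p) r = begin
  scale a r +P (+ 0 ∷ p *P r)  ≈⟨ +P-cong (≋-refl {scale a r}) (∷-cong ≡.refl (*P-comm p r)) ⟩
  scale a r +P (+ 0 ∷ r *P p)  ≈⟨ *P-∷ʳ r a p ⟨
  r *P (a ∷ p)                 ∎

*P-cong : ∀ {p p′ r r′} → p ≋ p′ → r ≋ r′ → p *P r ≋ p′ *P r′
*P-cong {p} {p′} {r} {r′} p≋p′ r≋r′ = begin
  p *P r    ≈⟨ *P-congˡ p r≋r′ ⟩
  p *P r′   ≈⟨ *P-comm p r′ ⟩
  r′ *P p   ≈⟨ *P-congˡ r′ p≋p′ ⟩
  r′ *P p′  ≈⟨ *P-comm r′ p′ ⟩
  p′ *P r′  ∎

*P-distribʳ : ∀ s p r → (p +P r) *P s ≋ p *P s +P r *P s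
*P-distribʳ s []      r       = ≋-refl
*P-distribʳ s (a ∷ p) []      = ≋-sym (+P-identityʳ _)
*P-distribʳ s (a ∷ p) (b ∷ r) = begin
  scale (a ℤ.+ b) s +P (+ 0 ∷ (p +P r) *P s)
    ≈⟨ +P-cong (scale-+ a b s) (∷-cong ≡.refl (*P-distribʳ s p r)) ⟩
  (scale a s +P scale b s) +P ((+ 0 ∷ p *P s) +P (+ 0 ∷ r *P s))
    ≈⟨ +P-interchange (scale a s) (scale b s) _ _ ⟩
  (scale a s +P (+ 0 ∷ p *P s)) +P (scale b s +P (+ 0 ∷ r *P s)) ∎

scale-*P : ∀ a p r → scale a p *P r ≋ scale a (p *P r)
scale-*P a []      r = ≋-refl
scale-*P a (b ∷ p) r = begin
  scale (a ℤ.* b) r +P (+ 0 ∷ scale a p *P r)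
    ≈⟨ +P-cong (≋-sym (scale-scale a b r)) (∷-cong (≡.sym (ℤ.*-zeroʳ a)) (scale-*P a p r)) ⟩
  scale a (scale b r) +P scale a (+ 0 ∷ p *P r)
    ≈⟨ scale-+P a (scale b r) _ ⟨
  scale a (scale b r +P (+ 0 ∷ p *P r)) ∎

*P-assoc : ∀ p r s → (p *P r) *P s ≋ p *P (r *P s)
*P-assoc []      r s = ≋-refl
*P-assoc (a ∷ p) r s = begin
  (scale a r +P (+ 0 ∷ p *P r)) *P s
    ≈⟨ *P-distribʳ s (scale a r) _ ⟩
  scale a r *P s +P (scale (+ 0) s +P (+ 0 ∷ p *P r *P s))
    ≈⟨ +P-cong (scale-*P a r s) (+P-cong (scale-zero s) (∷-cong ≡.refl (*P-assoc p r s))) ⟩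
  scale a (r *P s) +P (+ 0 ∷ p *P (r *P s)) ∎

*P-identityˡ : ∀ p → oneP *P p ≋ p
*P-identityˡ p = begin
  scale (+ 1) p +P (+ 0 ∷ [])  ≈⟨ +P-cong (scale-one p) 0∷[]≋[] ⟩
  p +P []                      ≈⟨ +P-identityʳ p ⟩
  p                            ∎

ℤ[q] : CommutativeRing 0ℓ 0ℓ
ℤ[q] = record
  { Carrier = Poly ; _≈_ = _≋_ ; _+_ = _+P_ ; _*_ = _*P_ ; -_ = negP ; 0# = zeroP ; 1# = oneP
  ; isCommutativeRing = record
    { isRing = record
      { +-isAbelianGroup = record
        { isGroup = record
          { isMonoid = record
            { isSemigroup = record
              { isMagma = record { isEquivalence = ≋-isEquivalence ; ∙-cong = +P-cong }
              ; assoc   = +P-assoc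
              }
            ; identity = (λ _ → ≋-refl) , +P-identityʳ
            }
          ; inverse = (λ p → ≋-trans (+P-comm (negP p) p) (negP-inverseʳ p)) , negP-inverseʳ
          ; ⁻¹-cong = negP-cong
          }
        ; comm = +P-comm
        }
      ; *-cong     = *P-cong
      ; *-assoc    = *P-assoc
      ; *-identity = *P-identityˡ , λ p → ≋-trans (*P-comm p oneP) (*P-identityˡ p)
      ; distrib    = (λ s p r → ≋-trans (*P-comm s (p +P r)) (≋-trans (*P-distribʳ s p r)
                        (+P-cong (*P-comm p s) (*P-comm r s)))) , *P-distribʳ
      }
    ; *-comm = *P-comm
    }
  }

-- Cancelling 1 - q^(n+1) in ℤ[q].

-- The constant coefficient of the product is that of the right factor, which is therefore zero.
-- Dropping it leaves the same equation for the rest of the list.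
1∷-noZeroDivisor : ∀ p r → (+ 1 ∷ p) *P r ≋ [] → r ≋ []
1∷-noZeroDivisor p []      _  = ≋-refl
1∷-noZeroDivisor p (b ∷ r) eq = ≋-trans (∷-cong b≡0 (1∷-noZeroDivisor p r tail)) 0∷[]≋[]
  where
  eq′ : scale b (+ 1 ∷ p) +P (+ 0 ∷ (+ 1 ∷ p) *P r) ≋ []
  eq′ = ≋-trans (≋-sym (*P-∷ʳ (+ 1 ∷ p) b r)) eq
  b≡0 : b ≡ + 0
  b≡0 = ≡.trans (≡.sym (≡.trans (ℤ.+-identityʳ (b ℤ.* + 1)) (ℤ.*-identityʳ b))) (at eq′ 0)
  tail : (+ 1 ∷ p) *P r ≋ []
  tail = begin
    (+ 1 ∷ p) *P r                  ≈⟨ +P-cong (scale-zero p) ≋-refl ⟨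
    scale (+ 0) p +P (+ 1 ∷ p) *P r ≡⟨ ≡.cong (λ b → scale b p +P (+ 1 ∷ p) *P r) b≡0 ⟨
    scale b p +P (+ 1 ∷ p) *P r     ≈⟨ ⟪ (λ i → at eq′ (suc i)) ⟫ ⟩
    []                              ∎

open CommutativeRing ℤ[q] using
  (semiring; ring; +-group; commutativeSemiring; distribˡ; *-congʳ; *-congˡ; +-congˡ; *-identityʳ; zeroʳ)
open Exp semiring using (_^_)
open import Algebra.Properties.Group +-group using (x∙y⁻¹≈ε⇒x≈y)
open import Algebra.Properties.Ring ring using (-‿distribʳ-*)

qVar : Poly
qVar = qPow 1

qPow≋qVar^ : ∀ n → qPow n ≋ qVar ^ n
qPow≋qVar^ zero    = ≋-refl
qPow≋qVar^ (suc n) = begin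
  + 0 ∷ qPow n                                              ≈⟨ ∷-cong ≡.refl (qPow≋qVar^ n) ⟩
  + 0 ∷ qVar ^ n                                             ≈⟨ ∷-cong ≡.refl (*P-identityˡ (qVar ^ n)) ⟨
  + 0 ∷ oneP *P qVar ^ n                                     ≈⟨ +P-cong (scale-zero (qVar ^ n)) ≋-refl ⟨
  scale (+ 0) (qVar ^ n) +P (+ 0 ∷ oneP *P qVar ^ n)          ∎

oneMinusQPow≋ : ∀ n → oneMinusQPow n ≋ oneP +P negP (qVar ^ n)
oneMinusQPow≋ n = +-congˡ (negP-cong (qPow≋qVar^ n))

oneMinusQPow-cancel : ∀ n {x y} → oneMinusQPow (suc n) *P x ≋ oneMinusQPow (suc n) *P y → x ≋ y
-- For a positive exponent the list computes to `+ 1 ∷ negP (qPow n)`.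
oneMinusQPow-cancel n {x} {y} eq = x∙y⁻¹≈ε⇒x≈y x y (1∷-noZeroDivisor (negP (qPow n)) (x +P negP y) (begin
  a *P (x +P negP y)           ≈⟨ distribˡ a x (negP y) ⟩
  a *P x +P a *P negP y        ≈⟨ +P-cong eq (≋-sym (-‿distribʳ-* a y)) ⟩
  a *P y +P negP (a *P y)      ≈⟨ negP-inverseʳ (a *P y) ⟩
  []                           ∎))
  where
  a : Poly
  a = oneMinusQPow (suc n)

qVar-regular : IsQRegular ℤ[q] qVar
qVar-regular n {x} {y} eq = oneMinusQPow-cancel n
  (≋-trans (*-congʳ {x} (oneMinusQPow≋ (suc n))) (≋-trans eq (*-congʳ {y} (≋-sym (oneMinusQPow≋ (suc n))))))

open QBinomials ℤ[q] qVar qVar-regular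

-- From `ℕ[q]` to non-negative coefficients.

NonNegative : Poly → Set
NonNegative p = ∀ i → + 0 ℤ.≤ coeff p i

+P-nonNegative : ∀ {p r} → NonNegative p → NonNegative r → NonNegative (p +P r)
+P-nonNegative {p} {r} 0≤p 0≤r i = ≡.subst (+ 0 ℤ.≤_) (≡.sym (coeff-+P p r i)) (ℤ.+-mono-≤ (0≤p i) (0≤r i))

scale-nonNegative : ∀ {a p} → + 0 ℤ.≤ a → NonNegative p → NonNegative (scale a p)
scale-nonNegative {a} {p} 0≤a 0≤p i = ≡.subst (+ 0 ℤ.≤_) (≡.sym (coeff-scale a p i))
  (≡.subst (ℤ._≤ a ℤ.* coeff p i) (ℤ.*-zeroʳ a) (ℤ.*-monoˡ-≤-nonNeg a {{ℤ.nonNegative 0≤a}} (0≤p i)))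

*P-nonNegative : ∀ {p r} → NonNegative p → NonNegative r → NonNegative (p *P r)
*P-nonNegative {[]}    0≤p 0≤r i = ℤ.≤-refl
*P-nonNegative {a ∷ p} {r} 0≤p 0≤r = +P-nonNegative {scale a r} (scale-nonNegative {a} {r} (0≤p 0) 0≤r)
  λ { zero → ℤ.≤-refl ; (suc i) → *P-nonNegative {p} (λ i → 0≤p (suc i)) 0≤r i }

ℕ[q]⇒nonNegative : ∀ {p} → ℕ[q] p → NonNegative p
ℕ[q]⇒nonNegative 0∈ i             = ℤ.≤-refl
ℕ[q]⇒nonNegative 1∈ zero          = ℤ.+≤+ z≤n
ℕ[q]⇒nonNegative 1∈ (suc i)       = ℤ.≤-refl
ℕ[q]⇒nonNegative q∈ zero          = ℤ.≤-refl
ℕ[q]⇒nonNegative q∈ (suc zero)    = ℤ.+≤+ z≤n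
ℕ[q]⇒nonNegative q∈ (suc (suc i)) = ℤ.≤-refl
ℕ[q]⇒nonNegative (_+∈_ {x} {y} x∈ y∈) = +P-nonNegative {x} {y} (ℕ[q]⇒nonNegative x∈) (ℕ[q]⇒nonNegative y∈)
ℕ[q]⇒nonNegative (_*∈_ {x} {y} x∈ y∈) = *P-nonNegative {x} {y} (ℕ[q]⇒nonNegative x∈) (ℕ[q]⇒nonNegative y∈)

absP : Poly → List ℕ
absP = map ∣_∣

absP-nonNegative : ∀ p → NonNegative p → map +_ (absP p) ≋ p
absP-nonNegative []      0≤p = ≋-refl
absP-nonNegative (a ∷ p) 0≤p = ∷-cong (ℤ.0≤i⇒+∣i∣≡i (0≤p 0)) (absP-nonNegative p (λ i → 0≤p (suc i)))

-- Fractions and their polynomial values.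

num den : Frac → Poly
num = proj₁
den = proj₂

infix 4 _≐_∙_

-- x = f · y as rational functions
record _≐_∙_ (x : Poly) (f : Frac) (y : Poly) : Set where
  constructor ⟪_⟫
  field cross-multiplied : x *P den f ≋ num f *P y

isNatPoly : ∀ f {x} → ℕ[q] x → x ≐ f ∙ oneP → IsNatPoly f
isNatPoly f {x} x∈ ⟪ eq ⟫ = absP x , at (begin
  map +_ (absP x) *P den f  ≈⟨ *-congʳ {den f} (absP-nonNegative x (ℕ[q]⇒nonNegative x∈)) ⟩
  x *P den f                ≈⟨ eq ⟩
  num f *P oneP             ≈⟨ *-identityʳ (num f) ⟩
  num f                     ∎)

prodOMQ≋ : ∀ a k → prodOMQ a k ≋ uProd a k
prodOMQ≋ a zero    = ≋-refl
prodOMQ≋ a (suc k) = *P-cong (prodOMQ≋ a k) (oneMinusQPow≋ (a ℕ.+ suc k))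

-- The bridge to the product definition: for `k ≤ n` this is `B*uProd` at `a = n ∸ k`; otherwise
-- both sides vanish.
qbinom-B : ∀ n k → B n k *P den (qbinom n k) ≋ num (qbinom n k)
qbinom-B n k with k ≤? n
... | yes k≤n = begin
  B n k *P prodOMQ 0 k               ≈⟨ *P-cong (B-congˡ k (≡.sym (ℕ.m∸n+n≡m k≤n))) (prodOMQ≋ 0 k) ⟩
  B (n ∸ k ℕ.+ k) k *P uProd 0 k     ≈⟨ B*uProd (n ∸ k) k ⟩
  uProd (n ∸ k) k                    ≈⟨ prodOMQ≋ (n ∸ k) k ⟨
  prodOMQ (n ∸ k) k                  ∎
... | no  k≰n = ≋-trans (*-identityʳ (B n k)) (B-vanish (ℕ.≰⇒> k≰n))

open import Algebra.Solver.Ring.NaturalCoefficients.Default commutativeSemiring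

-- Moves the last binomial of a fraction into the polynomial on the right. Repeated use leaves only
-- the leading quotient to be cross-multiplied.
*F-qbinom : ∀ n k f {x y} → x ≐ f ∙ (B n k *P y) → x ≐ (f *F qbinom n k) ∙ y
*F-qbinom n k (a , b) {x} {y} ⟪ eq ⟫ = ⟪ (begin
  x *P (b *P d)                ≈⟨ *P-assoc x b d ⟨
  x *P b *P d                  ≈⟨ *-congʳ {d} eq ⟩
  a *P (B n k *P y) *P d       ≈⟨ solve 4 (λ a b y d → a :* (b :* y) :* d := a :* (b :* d) :* y) ≋-refl a (B n k) y d ⟩
  a *P (B n k *P d) *P y       ≈⟨ *-congʳ {y} (*-congˡ {a} (qbinom-B n k)) ⟩
  a *P num (qbinom n k) *P y   ∎) ⟫
  where
  d : Poly
  d = den (qbinom n k)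

*F-qbinom-last : ∀ n k f {x} → x ≐ f ∙ B n k → x ≐ (f *F qbinom n k) ∙ oneP
*F-qbinom-last n k f ⟪ eq ⟫ = *F-qbinom n k f
  ⟪ ≋-trans eq (*-congˡ {num f} (≋-sym (*-identityʳ (B n k)))) ⟫

-- Positivity of the two expressions.

isNatPoly-expr1 : ∀ m n k → IsNatPoly (expr1 m (suc n) k)
isNatPoly-expr1 m n k = [ k≤1+n-case , 1+n<k-case ]′ (ℕ.≤-<-connex k (suc n))
  where
  b₁ b₂ b : Poly
  b₁ = B (suc n ℕ.+ k) (2 ℕ.* k)
  b₂ = B (suc m) (suc k) *P B (m ℕ.+ k) (suc k)
  b  = b₁ *P b₂
  f₀ f₁ f₂ : Frac
  f₀ = oneMinusQZ (+ suc n ℤ.- + k) *F (oneMinusQPow (suc k) , oneP)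
         *F (oneP , oneMinusQPow 1 *P oneMinusQPow (suc n))
  f₁ = f₀ *F qbinom (suc n ℕ.+ k) (2 ℕ.* k)
  f₂ = f₁ *F qbinom (suc m) (suc k)

  fromQuotient : ∀ {x} → ℕ[q] x → x *P den f₀ ≋ num f₀ *P b → IsNatPoly (expr1 m (suc n) k)
  fromQuotient x∈ eq = isNatPoly (expr1 m (suc n) k) x∈ (*F-qbinom-last (m ℕ.+ k) (suc k) f₂
    (*F-qbinom (suc m) (suc k) f₁ (*F-qbinom (suc n ℕ.+ k) (2 ℕ.* k) f₀ ⟪ eq ⟫)))

  -- The integer exponent is negative here, but `b₁` vanishes because its upper index is below 2k;
  -- the quotient is 0.
  1+n<k-case : suc n < k → IsNatPoly (expr1 m (suc n) k)
  1+n<k-case 1+n<k = fromQuotient 0∈ (≋-sym (begin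
    num f₀ *P (b₁ *P b₂)     ≈⟨ *-congˡ {num f₀} (*-congʳ {b₂} (B-vanish-2* 1+n<k)) ⟩
    num f₀ *P zeroP          ≈⟨ zeroʳ (num f₀) ⟩
    zeroP                    ∎))

  k≤1+n-case : k ≤ suc n → IsNatPoly (expr1 m (suc n) k)
  k≤1+n-case k≤1+n = fromQuotient (value₁∈ m n k) eq
    where
    exponent : + suc n ℤ.- + k ≡ + (suc n ∸ k)
    exponent = ≡.trans (ℤ.m-n≡m⊖n (suc n) k) (ℤ.⊖-≥ k≤1+n)
    eq : value₁ m n k *P den f₀ ≋ num f₀ *P b
    -- `oneMinusQZ` computes only once its argument has the form `+ a`.
    eq rewrite exponent = begin
      value₁ m n k *P (oneP *P oneP *P (oneMinusQPow 1 *P oneMinusQPow (suc n)))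
        ≈⟨ solve 3 (λ p v w → p :* (con 1 :* con 1 :* (v :* w)) := v :* w :* p) ≋-refl
             (value₁ m n k) (oneMinusQPow 1) (oneMinusQPow (suc n)) ⟩
      oneMinusQPow 1 *P oneMinusQPow (suc n) *P value₁ m n k
        ≈⟨ *-congʳ {value₁ m n k} (*P-cong (oneMinusQPow≋ 1) (oneMinusQPow≋ (suc n))) ⟩
      u 1 *P u (suc n) *P value₁ m n k
        ≈⟨ u*value₁ m n k ⟩
      u (suc n ∸ k) *P u (suc k) *P b
        ≈⟨ *-congʳ {b} (*P-cong (oneMinusQPow≋ (suc n ∸ k)) (oneMinusQPow≋ (suc k))) ⟨
      oneMinusQPow (suc n ∸ k) *P oneMinusQPow (suc k) *P b
        ≈⟨ *-congʳ {b} (*-identityʳ (oneMinusQPow (suc n ∸ k) *P oneMinusQPow (suc k))) ⟨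
      oneMinusQPow (suc n ∸ k) *P oneMinusQPow (suc k) *P oneP *P b ∎

isNatPoly-expr2 : ∀ m n j k → IsNatPoly (expr2 m (suc n) j k)
isNatPoly-expr2 m n j k = [ j≤k-case , k<j-case ]′ (ℕ.≤-<-connex j k)
  where
  c₁ c₂ b₁ b₂ b₃ b₄ : Poly
  c₁ = B n k
  c₂ = B (suc n ℕ.+ k) k
  b₁ = B (2 ℕ.* k) (j ℕ.+ k)
  b₂ = B (m ℕ.+ k) (2 ℕ.* k)
  b₃ = B m j
  b₄ = B (m ℕ.+ j) j

  -- The factors `c₁` and `c₂` already lie in `ℕ[q]`, so it suffices to find the quotient `y` of the
  -- remaining four binomials.
  fromQuotient : ∀ {y} → ℕ[q] y → u (suc k) *P y ≋ u 1 *P binoms₂ m k j → IsNatPoly (expr2 m (suc n) j k)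
  fromQuotient {y} y∈ eq = isNatPoly (expr2 m (suc n) j k) ((B∈ n k *∈ B∈ (suc n ℕ.+ k) k) *∈ y∈)
    (*F-qbinom-last (m ℕ.+ j) j f₅ (*F-qbinom m j f₄ (*F-qbinom (m ℕ.+ k) (2 ℕ.* k) f₃
      (*F-qbinom (2 ℕ.* k) (j ℕ.+ k) f₂ (*F-qbinom (suc n ℕ.+ k) k f₁ (*F-qbinom n k f₀ ⟪ (begin
        c₁ *P c₂ *P y *P oneMinusQPow (suc k)
          ≈⟨ *-congˡ {c₁ *P c₂ *P y} (oneMinusQPow≋ (suc k)) ⟩
        c₁ *P c₂ *P y *P u (suc k)
          ≈⟨ solve 4 (λ c d y v → c :* d :* y :* v := c :* d :* (v :* y)) ≋-refl c₁ c₂ y (u (suc k)) ⟩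
        c₁ *P c₂ *P (u (suc k) *P y)
          ≈⟨ *-congˡ {c₁ *P c₂} eq ⟩
        c₁ *P c₂ *P (u 1 *P (b₁ *P b₂ *P b₃ *P b₄))
          ≈⟨ solve 7 (λ c d v w x y z → c :* d :* (v :* (w :* x :* y :* z))
                       := v :* (c :* (d :* (w :* (x :* (y :* z)))))) ≋-refl c₁ c₂ (u 1) b₁ b₂ b₃ b₄ ⟩
        u 1 *P b
          ≈⟨ *-congʳ {b} (oneMinusQPow≋ 1) ⟨
        oneMinusQPow 1 *P b ∎) ⟫))))))
    where
    b : Poly
    b = c₁ *P (c₂ *P (b₁ *P (b₂ *P (b₃ *P b₄))))
    f₀ f₁ f₂ f₃ f₄ f₅ : Frac
    f₀ = oneMinusQPow 1 , oneMinusQPow (suc k)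
    f₁ = f₀ *F qbinom n k
    f₂ = f₁ *F qbinom (suc n ℕ.+ k) k
    f₃ = f₂ *F qbinom (2 ℕ.* k) (j ℕ.+ k)
    f₄ = f₃ *F qbinom (m ℕ.+ k) (2 ℕ.* k)
    f₅ = f₄ *F qbinom m j

  j≤k-case : j ≤ k → IsNatPoly (expr2 m (suc n) j k)
  j≤k-case j≤k = fromQuotient (B∈ k j *∈ saalschütz∈ m k (k ∸ j) j)
    (u*saalschütz m k j (k ∸ j) (ℕ.m+[n∸m]≡n j≤k))

  k<j-case : k < j → IsNatPoly (expr2 m (suc n) j k)
  k<j-case k<j = fromQuotient 0∈ (≋-trans (zeroʳ (u (suc k))) (≋-sym (begin
    u 1 *P (b₁ *P b₂ *P b₃ *P b₄)     ≈⟨ *-congˡ {u 1} (*-congʳ {b₄} (*-congʳ {b₃} (*-congʳ {b₂} (B-vanish 2k<j+k)))) ⟩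
    u 1 *P zeroP                      ≈⟨ zeroʳ (u 1) ⟩
    zeroP                             ∎)))
    where
    2k<j+k : 2 ℕ.* k < j ℕ.+ k
    2k<j+k = ≡.subst (_< j ℕ.+ k) (≡.cong (k ℕ.+_) (≡.sym (ℕ.+-identityʳ k))) (ℕ.+-monoˡ-< k k<j)

theorem2p1 : (m n j k : ℕ) → 1 ≤ m → 1 ≤ n →
    IsNatPoly (expr1 m n k) × IsNatPoly (expr2 m n j k)
theorem2p1 m (suc n) j k _ _ = isNatPoly-expr1 m n k , isNatPoly-expr2 m n j k
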